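{- Let $(d_1,\ldots,d_n)$ be a nonempty, nondecreasing sequence of nonnegative integers. Then every digraph on $n$ vertices whose (nondecreasingly ordered) outdegree sequence is $(d_1,\ldots,d_n)$ contains $2$ vertex disjoint cycles if and only if the sequence $(d_1,\ldots,d_n)$ is large, i.e. there exist integers $1\le r\le s\le n$ such that (a) $d_r\ge r$ and $d_s\ge s+1$, and (b) if $n\ge 2s-r+2$ and $d_{2s-r+2}=s+1$, then there is an integer $j\in[2s-r+3,n]$ with $d_j\ge j$.
   Context: Digraphs are finite; they may have loops and 2-cycles (pairs of opposite arcs $x\to y$, $y\to x$) but no parallel arcs. The outdegree of a vertex $x$ is the number of vertices $y$ (possibly $y=x$) with an arc $x\to y$; in particular a loop contributes $1$ to the outdegree. A cycle means a directed cycle; a loop counts as a cycle of length $1$ and a 2-cycle as a cycle of length $2$. The outdegree sequence of a digraph is the list of outdegrees of its vertices arranged in nondecreasing order. (If no digraph has the given outdegree sequence, the statement "every digraph ... contains 2 vertex disjoint cycles" holds vacuously.) -}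

module Defs where

open import Data.Nat using (ℕ; zero; suc; _+_; _*_; _∸_; _≤_)
open import Data.Bool using (Bool; true; false)
open import Data.Fin using (Fin)
open import Data.List using (List; []; _∷_; _++_; length; filter; map; allFin)
open import Data.List.Membership.Propositional using (_∈_)
open import Data.List.Relation.Unary.Unique.Propositional using (Unique)
open import Data.List.Relation.Unary.Linked using (Linked)
open import Data.List.Relation.Binary.Permutation.Propositional using (_↭_)
open import Data.Vec using (Vec; lookup; toList)
import Data.Vec as V
open import Data.Product using (Σ; ∃; ∃-syntax; _×_)
open import Data.Empty using (⊥)
open import Relation.Binary.PropositionalEquality using (_≡_)
open import Data.Bool.Properties using () renaming (_≟_ to _≟B_)
import Data.Fin as F

-- A digraph on vertex set Fin n: adjacency relation (loops and 2-cycles allowed,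
-- no parallel arcs since it is a relation).
Digraph : ℕ → Set
Digraph n = Fin n → Fin n → Bool

Arc : ∀ {n} → Digraph n → Fin n → Fin n → Set
Arc G x y = G x y ≡ true

outdeg : ∀ {n} → Digraph n → Fin n → ℕ
outdeg {n} G x = length (filter (λ y → G x y ≟B true) (allFin n))

-- the outdegree sequence of G, arranged in nondecreasing order, is d
-- (for nondecreasing d: the multiset of outdegrees equals the entries of d)
HasOutdegSeq : ∀ {n} → Digraph n → Vec ℕ n → Set
HasOutdegSeq {n} G d = map (outdeg G) (allFin n) ↭ toList d

-- a (directed) cycle: distinct vertices x ∷ xs with arcs between consecutive
-- vertices and from the last back to x (length 1 = loop, length 2 = 2-cycle)
IsCycle : ∀ {n} → Digraph n → List (Fin n) → Set
IsCycle G [] = ⊥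
IsCycle G (x ∷ xs) = Unique (x ∷ xs) × Linked (Arc G) ((x ∷ xs) ++ (x ∷ []))

Disjoint : ∀ {n} → List (Fin n) → List (Fin n) → Set
Disjoint c₁ c₂ = ∀ v → v ∈ c₁ → v ∈ c₂ → ⊥

HasTwoDisjointCycles : ∀ {n} → Digraph n → Set
HasTwoDisjointCycles G =
  ∃[ c₁ ] ∃[ c₂ ] (IsCycle G c₁ × IsCycle G c₂ × Disjoint c₁ c₂)

Nondecreasing : ∀ {n} → Vec ℕ n → Set
Nondecreasing {n} d = ∀ (i j : Fin n) → i F.≤ j → lookup d i ≤ lookup d j

-- 1-based access d_i (only used for 1 ≤ i ≤ n; returns 0 otherwise)
at : ∀ {n} → Vec ℕ n → ℕ → ℕ
at V.[] _ = 0
at (x V.∷ xs) zero = 0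
at (x V.∷ xs) (suc zero) = x
at (x V.∷ xs) (suc (suc k)) = at xs (suc k)

Large : ∀ {n} → Vec ℕ n → Set
Large {n} d =
  ∃[ r ] ∃[ s ]
    ( 1 ≤ r × r ≤ s × s ≤ n
    × r ≤ at d r × suc s ≤ at d s
    × (2 * s ∸ r + 2 ≤ n → at d (2 * s ∸ r + 2) ≡ suc s →
         ∃[ j ] (2 * s ∸ r + 3 ≤ j × j ≤ n × j ≤ at d j)))

{-# OPTIONS --safe #-}
-- Sets of vertices in which every vertex has a successor ("cores") stand for cycles.  Suppose no two cores are disjoint.
-- Deleting a vertex of minimum outdegree lowers r, so let r = 1; then the outdegrees are positive.  Contracting an arc x → z
-- costs outdegree only at common in-neighbours of x and z, so in a minimal counterexample every arc has one.
-- If (b) holds through some j, contractions inside the set L of vertices of outdegree < j keep the hypotheses unless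
-- L contains a cycle, and peeling sinks off the complement of such a cycle shows |L| ≥ j, a contradiction.
-- Otherwise at most 2s vertices have outdegree ≤ s + 1; trim all outdegrees to at most s + 2.  Around a well-chosen hub y
-- there is a rim S, a directed cycle of in-neighbours of y meeting every cycle among the vertices not reachable from y
-- without using its in-neighbours.  The members of that set outside S are dominated by all of S, giving some rim vertex outdegree s + 3.
-- Conversely a sequence that is not large is bounded by the outdegrees of a digraph in which either all cycles share
-- a hub, or every cycle is the rim of a wheel or passes through its hub and rim.
module Submission where

open import Defs
open import Data.Bool using (Bool; true; false; if_then_else_) renaming (_≟_ to _≟ᵇ_)
open import Data.Empty using (⊥; ⊥-elim)
open import Data.Fin using (Fin; zero; suc; toℕ; fromℕ<)
open import Data.Fin.Properties using (_≟_; any?; all?; toℕ<n; toℕ-injective; toℕ-fromℕ<)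
open import Data.Fin.Subset.Properties using (anySubset?)
open import Data.List using (List; []; _∷_; _++_; length; filter; map; allFin; tabulate)
open import Data.List.Properties using (map-tabulate; tabulate-cong)
open import Data.List.Membership.Propositional using (_∈_)
open import Data.List.Relation.Binary.Permutation.Propositional using (↭-reflexive)
open import Data.List.Relation.Binary.Permutation.Propositional.Properties using (filter-↭; ↭-length)
open import Data.List.Relation.Unary.All as All using ([]; _∷_)
open import Data.List.Relation.Unary.AllPairs using ([]; _∷_)
open import Data.List.Relation.Unary.Any using (here; there)
open import Data.List.Relation.Unary.Linked using (Linked; []; [-]; _∷_)
open import Data.List.Relation.Unary.Unique.Propositional using (Unique)
open import Data.Nat using (ℕ; zero; suc; _+_; _*_; _∸_; _≤_; _<_; _≤?_; _<?_; z≤n; s≤s; s≤s⁻¹)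
open import Data.Nat.Induction using (<-wellFounded)
open import Data.Nat.Properties using (≤-refl; ≤-reflexive; ≤-trans; <-≤-trans; ≤-<-trans; <-trans; <-irrefl; <⇒≤; <⇒≱; ≰⇒>; ≮⇒≥; n≤1+n; n<1+n; m≤m+n; m≤n+m; +-monoʳ-≤; +-mono-≤; +-suc; +-comm; +-assoc; +-identityʳ; suc-injective; m≤n⇒m<n∨m≡n; 1+n≰n; ≤-antisym; +-cancelˡ-≤; m+n∸m≡n; m+[n∸m]≡n; ≤-total; <-cmp) renaming (_≟_ to _≟ⁿ_)
open import Data.Product using (∃-syntax; _×_; _,_; proj₁; proj₂)
open import Data.Sum using (_⊎_; inj₁; inj₂)
open import Data.Vec using (Vec; lookup; toList)
import Data.Vec as V
open import Function using (_∘_; id; case_of_)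
open import Function.Bundles using (_⇔_; mk⇔)
open import Induction.WellFounded using (Acc; acc)
open import Relation.Nullary using (Dec; yes; no; ¬_; does; contradiction)
open import Relation.Nullary.Decidable using (_×-dec_; _⊎-dec_; _→-dec_; ¬?; dec-true; decidable-stable; map′)
open import Relation.Binary.PropositionalEquality using (_≡_; _≢_; refl; sym; trans; cong; cong₂; subst; ≢-sym)
open import Data.Vec.Properties using (lookup∘tabulate)
open import Data.Nat.Tactic.RingSolver using (solve-∀)
import Data.List.Membership.DecPropositional as DecMembership
open import Relation.Binary.Definitions using (tri<; tri≈; tri>)

private open module DecFin {n} = DecMembership (_≟_ {n}) using (_∈?_)

private variable
  n : ℕ

-- Vertex sets and their sizes

VSet : ℕ → Set
VSet n = Fin n → Bool

-- Wrapping membership in a record keeps the set and the vertex inferable from its type.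
infix 4 _∋_ _∋?_ _⊆_
record _∋_ (P : VSet n) (v : Fin n) : Set where
  constructor mem
  field holds : P v ≡ true
open _∋_

_∋?_ : (P : VSet n) (v : Fin n) → Dec (P ∋ v)
P ∋? v = map′ mem holds (P v ≟ᵇ true)

_⊆_ : VSet n → VSet n → Set
P ⊆ Q = ∀ v → P ∋ v → Q ∋ v

opaque
  comp : {Q : Fin n → Set} → (∀ v → Dec (Q v)) → VSet n
  comp Q? v = does (Q? v)

  comp⁺ : {Q : Fin n → Set} {Q? : ∀ v → Dec (Q v)} {v : Fin n} → Q v → comp Q? ∋ v
  comp⁺ {Q? = Q?} {v} q = mem (dec-true (Q? v) q)

  comp⁻ : {Q : Fin n → Set} {Q? : ∀ v → Dec (Q v)} {v : Fin n} → comp Q? ∋ v → Q v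
  comp⁻ {Q? = Q?} {v} (mem e) with Q? v
  ... | yes q = q
  comp⁻ (mem ()) | no _

infixl 6 _∖_ _⊕_ _─_
opaque
  _∖_ : VSet n → Fin n → VSet n
  P ∖ x = comp λ v → (P ∋? v) ×-dec ¬? (v ≟ x)

  _⊕_ : VSet n → Fin n → VSet n
  P ⊕ x = comp λ v → (P ∋? v) ⊎-dec (v ≟ x)

  _─_ : VSet n → VSet n → VSet n
  P ─ Q = comp λ v → (P ∋? v) ×-dec ¬? (Q ∋? v)

  ∖⁺ : {P : VSet n} {x v : Fin n} → P ∋ v → v ≢ x → (P ∖ x) ∋ v
  ∖⁺ p ne = comp⁺ (p , ne)

  ∖⁻ : {P : VSet n} {x v : Fin n} → (P ∖ x) ∋ v → P ∋ v × v ≢ x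
  ∖⁻ = comp⁻

  ⁅_⁆ : Fin n → VSet n
  ⁅ x ⁆ = comp λ v → v ≟ x

  ⁅⁆⁺ : {x : Fin n} → ⁅ x ⁆ ∋ x
  ⁅⁆⁺ = comp⁺ refl

  ⁅⁆⁻ : {x v : Fin n} → ⁅ x ⁆ ∋ v → v ≡ x
  ⁅⁆⁻ = comp⁻

  ⊕-old : {P : VSet n} {x v : Fin n} → P ∋ v → P ⊕ x ∋ v
  ⊕-old p = comp⁺ (inj₁ p)

  ⊕-new : {P : VSet n} {x : Fin n} → P ⊕ x ∋ x
  ⊕-new = comp⁺ (inj₂ refl)

  ⊕⁻ : {P : VSet n} {x v : Fin n} → P ⊕ x ∋ v → P ∋ v ⊎ v ≡ x
  ⊕⁻ = comp⁻

  ─⁺ : {P Q : VSet n} {v : Fin n} → P ∋ v → ¬ Q ∋ v → P ─ Q ∋ v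
  ─⁺ p nq = comp⁺ (p , nq)

  ─⁻ : {P Q : VSet n} {v : Fin n} → P ─ Q ∋ v → P ∋ v × ¬ Q ∋ v
  ─⁻ = comp⁻

∖-⊆ : (P : VSet n) (x : Fin n) → P ∖ x ⊆ P
∖-⊆ P x v p = proj₁ (∖⁻ p)

opaque
  unfolding comp _∖_
  count : VSet n → ℕ
  count {zero}  P = 0
  count {suc n} P = (if P zero then 1 else 0) + count (P ∘ suc)

  count-mono : {P Q : VSet n} → P ⊆ Q → count P ≤ count Q
  count-mono {zero} s = z≤n
  count-mono {suc n} {P} {Q} s = +-mono-≤ head (count-mono λ v p → mem (holds (s (suc v) (mem (holds p)))))
    where
    head : (if P zero then 1 else 0) ≤ (if Q zero then 1 else 0)
    head with P zero in e
    ... | false = z≤n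
    ... | true rewrite holds (s zero (mem e)) = ≤-refl

  count-empty : {P : VSet n} → (∀ v → ¬ P ∋ v) → count P ≡ 0
  count-empty {zero} h = refl
  count-empty {suc n} {P} h with P zero in e
  ... | true  = contradiction (mem e) (h zero)
  ... | false = count-empty λ v p → h (suc v) (mem (holds p))

  count-∖ : {P : VSet n} {x : Fin n} → P ∋ x → count P ≡ suc (count (P ∖ x))
  count-∖ {P = P} {zero} p = cong₂ _+_ heads (≤-antisym (count-mono to) (count-mono from))
    where
    to : (P ∘ suc) ⊆ ((P ∖ zero) ∘ suc)
    to v q = mem (holds (∖⁺ {P = P} {zero} {suc v} (mem (holds q)) λ ()))
    from : ((P ∖ zero) ∘ suc) ⊆ (P ∘ suc)
    from v q = mem (holds (∖-⊆ P zero (suc v) (mem (holds q))))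
    heads : (if P zero then 1 else 0) ≡ suc (if (P ∖ zero) zero then 1 else 0)
    heads with P zero | holds p
    ... | true | refl = refl
  count-∖ {P = P} {suc x} p =
    trans (cong₂ _+_ heads (trans (count-∖ {P = P ∘ suc} {x} (mem (holds p))) (cong suc (≤-antisym (count-mono to) (count-mono from))))) (+-suc _ _)
    where
    to : (P ∘ suc) ∖ x ⊆ ((P ∖ suc x) ∘ suc)
    to v q = let a , b = ∖⁻ {P = P ∘ suc} q in mem (holds (∖⁺ {P = P} {suc x} {suc v} (mem (holds a)) λ { refl → b refl }))
    from : ((P ∖ suc x) ∘ suc) ⊆ (P ∘ suc) ∖ x
    from v q = let a , b = ∖⁻ {P = P} {suc x} {suc v} (mem (holds q)) in ∖⁺ {P = P ∘ suc} (mem (holds a)) λ { refl → b refl }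
    heads : (if P zero then 1 else 0) ≡ (if (P ∖ suc x) zero then 1 else 0)
    heads with P zero
    ... | true  = refl
    ... | false = refl

insert-count : {P : VSet n} {x : Fin n} {k : ℕ} → P ∋ x → k ≤ count (P ∖ x) → suc k ≤ count P
insert-count p h = subst (_ ≤_) (sym (count-∖ p)) (s≤s h)

∖-count : {P : VSet n} {x : Fin n} {k : ℕ} → P ∋ x → count P ≤ suc k → count (P ∖ x) ≤ k
∖-count p h = s≤s⁻¹ (subst (_≤ _) (count-∖ p) h)

count-mono-< : {P Q : VSet n} {x : Fin n} → P ⊆ Q → Q ∋ x → ¬ P ∋ x → count P < count Q
count-mono-< s q np = insert-count q (count-mono λ v p → ∖⁺ (s v p) λ { refl → np p })

count≤suc∖ : (P : VSet n) (x : Fin n) → count P ≤ suc (count (P ∖ x))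
count≤suc∖ P x with P ∋? x
... | yes p = ≤-reflexive (count-∖ p)
... | no np = ≤-trans (count-mono λ v p → ∖⁺ p λ { refl → np p }) (n≤1+n _)

count-⊕ : (P : VSet n) (x : Fin n) → count (P ⊕ x) ≤ suc (count P)
count-⊕ P x = ≤-trans (count≤suc∖ (P ⊕ x) x) (s≤s (count-mono step))
  where
  step : (P ⊕ x) ∖ x ⊆ P
  step v p with ∖⁻ p
  ... | a , b with ⊕⁻ a
  ... | inj₁ q = q
  ... | inj₂ q = contradiction q b

count-⊕-new : {P : VSet n} {x : Fin n} → ¬ P ∋ x → suc (count P) ≤ count (P ⊕ x)
count-⊕-new np = count-mono-< (λ v → ⊕-old) ⊕-new np

count-pos : {P : VSet n} {x : Fin n} → P ∋ x → 1 ≤ count P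
count-pos p = insert-count p z≤n

count<⇒∃ : {P Q : VSet n} → count P < count Q → ∃[ v ] (Q ∋ v × ¬ P ∋ v)
count<⇒∃ {P = P} {Q} lt with any? (λ v → (Q ∋? v) ×-dec ¬? (P ∋? v))
... | yes r = r
... | no nr = contradiction (count-mono λ v q → decidable-stable (P ∋? v) λ np → nr (v , q , np)) (<⇒≱ lt)

count-⁅⁆ : (x : Fin n) → count ⁅ x ⁆ ≡ 1
count-⁅⁆ x = trans (count-∖ ⁅⁆⁺) (cong suc (count-empty λ v p → let q , ne = ∖⁻ p in ne (⁅⁆⁻ q)))

count-pos⁻ : {P : VSet n} → 1 ≤ count P → ∃[ v ] P ∋ v
count-pos⁻ {P = P} h with any? (P ∋?_)
... | yes r = r
... | no nr = contradiction (subst (1 ≤_) (count-empty λ v p → nr (v , p)) h) λ ()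

count-─ : {P Q : VSet n} → Q ⊆ P → count (P ─ Q) + count Q ≡ count P
count-─ {n} {P} {Q} = go _ P Q refl
  where
  go : ∀ k (P Q : VSet n) → count Q ≡ k → Q ⊆ P → count (P ─ Q) + count Q ≡ count P
  go zero P Q e s = trans (cong (count (P ─ Q) +_) e) (trans (+-identityʳ _) (≤-antisym
    (count-mono λ v p → proj₁ (─⁻ p))
    (count-mono λ v p → ─⁺ p λ q → contradiction (subst (1 ≤_) e (count-pos q)) λ ())))
  go (suc k) P Q e s with count-pos⁻ {P = Q} (subst (1 ≤_) (sym e) (s≤s z≤n))
  ... | q , q∈Q = trans (cong (count (P ─ Q) +_) (count-∖ q∈Q)) (trans (+-suc _ _)
      (trans (cong suc (trans (cong (_+ count (Q ∖ q)) same)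
        (go k (P ∖ q) (Q ∖ q) (suc-injective (trans (sym (count-∖ q∈Q)) e)) λ v p → let a , b = ∖⁻ p in ∖⁺ (s v a) b)))
        (sym (count-∖ (s q q∈Q)))))
    where
    same : count (P ─ Q) ≡ count ((P ∖ q) ─ (Q ∖ q))
    same = ≤-antisym
      (count-mono λ v p → let a , b = ─⁻ p in ─⁺ (∖⁺ a λ { refl → b q∈Q }) λ c → b (proj₁ (∖⁻ c)))
      (count-mono λ v p → let a , b = ─⁻ p ; c , d = ∖⁻ a in ─⁺ c λ f → b (∖⁺ f d))

opaque
  unfolding count
  -- Keeps the `k` least members of `P`; it serves to trim an out-neighbourhood to a prescribed
  -- size.
  take : ℕ → VSet n → VSet n
  take zero P _ = false
  take {suc n} (suc k) P zero = P zero
  take {suc n} (suc k) P (suc v) = if P zero then take k (P ∘ suc) v else take (suc k) (P ∘ suc) v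

  take-⊆ : (k : ℕ) (P : VSet n) → take k P ⊆ P
  take-⊆ zero P v (mem ())
  take-⊆ (suc k) P zero p = mem (holds p)
  take-⊆ (suc k) P (suc v) (mem e) with P zero
  ... | true  = mem (holds (take-⊆ k (P ∘ suc) v (mem e)))
  ... | false = mem (holds (take-⊆ (suc k) (P ∘ suc) v (mem e)))

  count-take-≤ : (k : ℕ) (P : VSet n) → count (take k P) ≤ k
  count-take-≤ zero P = ≤-reflexive (count-empty {P = take zero P} λ { _ (mem ()) })
  count-take-≤ {zero} (suc k) P = z≤n
  count-take-≤ {suc n} (suc k) P with P zero
  ... | true  = s≤s (count-take-≤ k (P ∘ suc))
  ... | false = count-take-≤ (suc k) (P ∘ suc)

  count-take : (k : ℕ) (P : VSet n) → k ≤ count P → count (take k P) ≡ k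
  count-take zero P _ = count-empty {P = take zero P} λ { _ (mem ()) }
  count-take {suc n} (suc k) P h with P zero
  ... | true  = cong suc (count-take k (P ∘ suc) (s≤s⁻¹ h))
  ... | false = count-take (suc k) (P ∘ suc) h

  take-all : (k : ℕ) (P : VSet n) → count P ≤ k → P ⊆ take k P
  take-all {suc n} zero P h v p = contradiction (≤-trans (count-pos p) h) λ ()
  take-all {suc n} (suc k) P h zero p = mem (holds p)
  take-all {suc n} (suc k) P h (suc v) (mem e) = mem (tail h)
    where
    tail : (if P zero then 1 else 0) + count (P ∘ suc) ≤ suc k →
           (if P zero then take k (P ∘ suc) v else take (suc k) (P ∘ suc) v) ≡ true
    tail h with P zero
    ... | true  = holds (take-all k (P ∘ suc) (s≤s⁻¹ h) v (mem e))
    ... | false = holds (take-all (suc k) (P ∘ suc) h v (mem e))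

-- Cores and intercyclic digraphs

opaque
  In : Digraph n → Fin n → VSet n
  In G z u = G u z

  In⁺ : {G : Digraph n} {u z : Fin n} → G u ∋ z → In G z ∋ u
  In⁺ (mem e) = mem e

  In⁻ : {G : Digraph n} {u z : Fin n} → In G z ∋ u → G u ∋ z
  In⁻ (mem e) = mem e

-- A set contains a directed cycle exactly when it contains a core.
record Core (G : Digraph n) (Y : VSet n) : Set where
  constructor core
  field
    {base} : Fin n
    base∈  : Y ∋ base
    next   : ∀ v → Y ∋ v → ∃[ w ] (Y ∋ w × G v ∋ w)

-- A core of the reversed digraph; arguments that follow arcs backwards end in one of these.
record InCore (G : Digraph n) (Y : VSet n) : Set where
  constructor inCore
  field
    {base} : Fin n
    base∈  : Y ∋ base
    prev   : ∀ v → Y ∋ v → ∃[ u ] (Y ∋ u × G u ∋ v)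

Intercyclic : Digraph n → Set
Intercyclic G = ∀ Y Z → Core G Y → Core G Z → ¬ (∀ v → Y ∋ v → ¬ Z ∋ v)

Intercyclic-⊆ : {G H : Digraph n} → (∀ v → H v ⊆ G v) → Intercyclic G → Intercyclic H
Intercyclic-⊆ s inter Y Z (core y ny) (core z nz) = inter Y Z (lift y ny) (lift z nz)
  where
  lift : ∀ {Y y} → Y ∋ y → (∀ v → Y ∋ v → ∃[ w ] (Y ∋ w × _)) → Core _ Y
  lift y ny = core y λ v p → let w , q , a = ny v p in w , q , s v w a

stuck? : (G : Digraph n) (Y : VSet n) → Dec (∃[ v ] (Y ∋ v × ¬ (∃[ w ] (Y ∋ w × G v ∋ w))))
stuck? G Y = any? λ v → (Y ∋? v) ×-dec ¬? (any? λ w → (Y ∋? w) ×-dec (G v ∋? w))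

unstuck : {G : Digraph n} {Y : VSet n} → ¬ (∃[ v ] (Y ∋ v × ¬ (∃[ w ] (Y ∋ w × G v ∋ w)))) →
          ∀ v → Y ∋ v → ∃[ w ] (Y ∋ w × G v ∋ w)
unstuck {G = G} {Y} ns v p = decidable-stable (any? λ w → (Y ∋? w) ×-dec (G v ∋? w)) λ nw → ns (v , p , nw)

sourceOrInCore : (G : Digraph n) (Y : VSet n) {y : Fin n} → Y ∋ y →
                 (∃[ v ] (Y ∋ v × (∀ u → Y ∋ u → ¬ G u ∋ v))) ⊎ InCore G Y
sourceOrInCore G Y y with any? (λ v → (Y ∋? v) ×-dec ¬? (any? λ u → (Y ∋? u) ×-dec (G u ∋? v)))
... | yes (v , p , nu) = inj₁ (v , p , λ u q a → nu (u , q , a))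
... | no ns = inj₂ (inCore y λ v p →
    decidable-stable (any? λ u → (Y ∋? u) ×-dec (G u ∋? v)) λ nu → ns (v , p , nu))

-- Sinks of an in-core can be discarded until every vertex has a successor.
InCore⇒Core : {G : Digraph n} {Y : VSet n} → InCore G Y → ∃[ Z ] (Core G Z × Z ⊆ Y)
InCore⇒Core {G = G} {Y} = go (count Y) Y ≤-refl
  where
  go : ∀ k Y → count Y ≤ k → InCore G Y → ∃[ Z ] (Core G Z × Z ⊆ Y)
  go zero Y h (inCore y _) = contradiction (≤-trans (count-pos y) h) λ ()
  go (suc k) Y h (inCore y prev) with stuck? G Y
  ... | no ns = Y , core y (unstuck ns) , λ _ p → p
  ... | yes (v , p , dead) =
    let u , q , a = prev v p
        Z , c , s = go k (Y ∖ v) (∖-count p h) (inCore (∖⁺ q (alive a p)) λ x px →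
          let w , qw , aw = prev x (∖-⊆ Y v x px) in w , ∖⁺ qw (alive aw (∖-⊆ Y v x px)) , aw)
    in Z , c , λ x px → ∖-⊆ Y v x (s x px)
    where
    alive : ∀ {u x} → G u ∋ x → Y ∋ x → u ≢ v
    alive a px refl = dead (_ , px , a)

-- A sink of `Y` lies in no core inside `Y`, so discarding it loses nothing. What is left in the end
-- is empty or itself a core.
hasCore? : (G : Digraph n) (Y : VSet n) → Dec (∃[ Z ] (Core G Z × Z ⊆ Y))
hasCore? G Y = go (count Y) Y ≤-refl
  where
  go : ∀ k Y → count Y ≤ k → Dec (∃[ Z ] (Core G Z × Z ⊆ Y))
  go zero Y h = no λ { (Z , core z _ , s) → contradiction (≤-trans (count-pos (s _ z)) h) λ () }
  go (suc k) Y h with stuck? G Y | any? (Y ∋?_)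
  ... | no ns | yes (y , p) = yes (Y , core p (unstuck ns) , λ _ q → q)
  ... | no _  | no ny = no λ { (Z , core z _ , s) → ny (_ , s _ z) }
  ... | yes (v , p , dead) | _ = map′
    (λ { (Z , c , s) → Z , c , λ x px → ∖-⊆ Y v x (s x px) })
    (λ { (Z , c , s) → Z , c , λ x px → ∖⁺ (s x px) λ { refl →
      let w , q , a = Core.next c x px in dead (w , s w q , a) } })
    (go k (Y ∖ v) (∖-count p h))

-- Vertices of low outdegree

deg : Digraph n → Fin n → ℕ
deg G v = count (G v)

low : VSet n → Digraph n → ℕ → VSet n
low V G k = comp λ v → (V ∋? v) ×-dec (deg G v ≤? k)

low⁺ : {V : VSet n} {G : Digraph n} {k : ℕ} {v : Fin n} → V ∋ v → deg G v ≤ k → low V G k ∋ v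
low⁺ p h = comp⁺ (p , h)

low⁻ : {V : VSet n} {G : Digraph n} {k : ℕ} {v : Fin n} → low V G k ∋ v → V ∋ v × deg G v ≤ k
low⁻ = comp⁻

low# : VSet n → Digraph n → ℕ → ℕ
low# V G k = count (low V G k)

low-mono : {V : VSet n} {G : Digraph n} {j k : ℕ} → j ≤ k → low# V G j ≤ low# V G k
low-mono h = count-mono λ v p → let a , b = low⁻ p in low⁺ a (≤-trans b h)

Within : VSet n → Digraph n → Set
Within V G = ∀ u w → G u ∋ w → V ∋ u × V ∋ w

-- If all cycles meet Q, sinks can be added to Q one at a time.
enclose : {V : VSet n} {G : Digraph n} {Q : VSet n} → Within V G → Q ⊆ V →
          (∀ Y → Core G Y → ¬ (∀ v → Y ∋ v → ¬ Q ∋ v)) →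
          ∀ m → m + count Q ≤ count V →
          ∃[ Z ] (Q ⊆ Z × count Z ≡ m + count Q × (∀ v → Z ∋ v → ¬ Q ∋ v → V ∋ v × deg G v < m + count Q))
enclose {Q = Q} wi qv ac zero h = Q , (λ _ p → p) , refl , λ v p np → contradiction p np
enclose {V = V} {G} {Q} wi qv ac (suc m) h with enclose wi qv ac m (≤-trans (n≤1+n _) h)
... | Z , qz , cz , dz with stuck? G (V ─ Z)
... | no ns = ⊥-elim (ac (V ─ Z) (core (─⁺ fresh∈V fresh∉Z) (unstuck ns)) λ v p q → proj₂ (─⁻ p) (qz v q))
  where
  fresh = count<⇒∃ {P = Z} {V} (subst (_< count V) (sym cz) h)
  fresh∈V = proj₁ (proj₂ fresh)
  fresh∉Z = proj₂ (proj₂ fresh)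
... | yes (v , p , dead) = Z ⊕ v , (λ x q → ⊕-old (qz x q))
    , ≤-antisym (≤-trans (count-⊕ Z v) (s≤s (≤-reflexive cz))) (subst (λ c → suc c ≤ count (Z ⊕ v)) cz (count-⊕-new (proj₂ (─⁻ p))))
    , degs
  where
  -- The added sink sends all its arcs into `Z`, so its outdegree is at most the size of `Z` before
  -- the addition.
  out : G v ⊆ Z
  out w a = decidable-stable (Z ∋? w) λ nz → dead (w , ─⁺ (proj₂ (wi v w a)) nz , a)
  degs : ∀ x → (Z ⊕ v) ∋ x → ¬ Q ∋ x → V ∋ x × deg G x < suc m + count Q
  degs x px nq with ⊕⁻ px
  ... | inj₁ q = let a , b = dz x q nq in a , ≤-trans b (n≤1+n _)
  ... | inj₂ refl = proj₁ (─⁻ p) , s≤s (subst (count (G v) ≤_) cz (count-mono out))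

deg≤count : {V : VSet n} {G : Digraph n} → Within V G → ∀ v → deg G v ≤ count V
deg≤count wi v = count-mono λ w a → proj₂ (wi v w a)

big-vertex : {V : VSet n} {G : Digraph n} {k : ℕ} → low# V G k < count V → ∃[ v ] (V ∋ v × k < deg G v)
big-vertex {G = G} {k} h = let v , p , nl = count<⇒∃ h in v , p , ≰⇒> λ d → nl (low⁺ p d)

-- Every cycle meets the loop, so `enclose` adds `suc σ` vertices to it, all of outdegree at most
-- `suc σ`: one more than allowed. There is room for them because some vertex has outdegree at least
-- `2 + σ`.
loopless : {V : VSet n} {G : Digraph n} {σ : ℕ} → Within V G → Intercyclic G →
           low# V G (suc σ) ≤ σ → σ < count V → ∀ v → ¬ G v ∋ v
loopless {V = V} {G} {σ} wi inter lo big v a = 1+n≰n (≤-trans many lo)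
  where
  coreQ : Core G ⁅ v ⁆
  coreQ = core ⁅⁆⁺ λ x p → v , ⁅⁆⁺ , subst (λ x → G x ∋ v) (sym (⁅⁆⁻ p)) a
  size : suc σ + count ⁅ v ⁆ ≡ suc (suc σ)
  size = trans (cong (suc σ +_) (count-⁅⁆ v)) (+-comm (suc σ) 1)
  room : suc σ + count ⁅ v ⁆ ≤ count V
  room = let u , _ , d = big-vertex (≤-<-trans lo big) in
    ≤-trans (≤-reflexive size) (≤-trans d (deg≤count wi u))
  closed = enclose {Q = ⁅ v ⁆} wi (λ x p → subst (V ∋_) (sym (⁅⁆⁻ p)) (proj₁ (wi v v a)))
    (λ Y c dis → inter Y ⁅ v ⁆ c coreQ dis) (suc σ) room
  Z = proj₁ closed
  many : suc σ ≤ low# V G (suc σ)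
  many = ≤-trans (s≤s⁻¹ (≤-trans (≤-reflexive (sym (trans (proj₁ (proj₂ (proj₂ closed))) size))) (count≤suc∖ Z v)))
    (count-mono λ x p → let q , ne = ∖⁻ p ; b , d = proj₂ (proj₂ (proj₂ closed)) x q (λ r → ne (⁅⁆⁻ r))
      in low⁺ b (s≤s⁻¹ (≤-trans d (≤-reflexive size))))

-- Deletion and contraction

delete : Digraph n → Fin n → Digraph n
delete G x u = comp λ w → (G u ∋? w) ×-dec ¬? (u ≟ x) ×-dec ¬? (w ≟ x)

delete⁻ : (G : Digraph n) {x u w : Fin n} → delete G x u ∋ w → G u ∋ w × u ≢ x × w ≢ x
delete⁻ G = comp⁻

module _ {V : VSet n} {G : Digraph n} (wi : Within V G) (x : Fin n) where

  delete-within : Within (V ∖ x) (delete G x)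
  delete-within u w a = let b , p , q = delete⁻ G a ; c , d = wi u w b in ∖⁺ c p , ∖⁺ d q

  delete-inter : Intercyclic G → Intercyclic (delete G x)
  delete-inter = Intercyclic-⊆ λ v w a → proj₁ (delete⁻ G a)

  deg-delete-unused : (∀ u → ¬ G u ∋ x) → ∀ v → v ≢ x → deg G v ≤ deg (delete G x) v
  deg-delete-unused unused v ne = count-mono λ w a → comp⁺ (a , ne , λ { refl → unused v a })

  deg-delete : ∀ v → v ≢ x → deg G v ≤ suc (deg (delete G x) v)
  deg-delete v ne = ≤-trans (count≤suc∖ (G v) x)
    (s≤s (count-mono λ w a → let b , q = ∖⁻ a in comp⁺ (b , ne , q)))

-- Arcs into `x` are redirected to `y` and `x` is left isolated, so the vertex type does not change.
-- An arc from `y` to `x` turns into a loop at `y`.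
contract : Digraph n → (x y : Fin n) → Digraph n
contract G x y u = comp λ w → ¬? (u ≟ x) ×-dec ¬? (w ≟ x) ×-dec ((G u ∋? w) ⊎-dec ((w ≟ y) ×-dec (G u ∋? x)))

contract⁻ : (G : Digraph n) {x y u w : Fin n} → contract G x y u ∋ w →
            u ≢ x × w ≢ x × (G u ∋ w ⊎ (w ≡ y × G u ∋ x))
contract⁻ G = comp⁻

module _ {V : VSet n} {G : Digraph n} (wi : Within V G) {x y : Fin n} (xy : G x ∋ y) (x≢y : x ≢ y) where

  private G′ = contract G x y

  old⁺ : ∀ {u w} → u ≢ x → w ≢ x → G u ∋ w → G′ u ∋ w
  old⁺ p q a = comp⁺ (p , q , inj₁ a)

  new⁺ : ∀ {u} → u ≢ x → G u ∋ x → G′ u ∋ y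
  new⁺ p a = comp⁺ (p , ≢-sym x≢y , inj₂ (refl , a))

  contract-within : Within (V ∖ x) G′
  contract-within u w a with contract⁻ G a
  ... | p , q , inj₁ b = let c , d = wi u w b in ∖⁺ c p , ∖⁺ d q
  ... | p , q , inj₂ (refl , b) = ∖⁺ (proj₁ (wi u x b)) p , ∖⁺ (proj₂ (wi x y xy)) q

  core-through : ∀ {Y} → Core G′ Y → Y ∋ y → Core G (Y ⊕ x)
  core-through {Y} (core b nx) y∈Y = core (⊕-old b) step
    where
    step : ∀ v → (Y ⊕ x) ∋ v → ∃[ w ] ((Y ⊕ x) ∋ w × G v ∋ w)
    step v p with ⊕⁻ p
    ... | inj₂ refl = y , ⊕-old y∈Y , xy
    ... | inj₁ q with nx v q
    ... | w , r , a with contract⁻ G a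
    ... | _ , _ , inj₁ e = w , ⊕-old r , e
    ... | _ , _ , inj₂ (_ , e) = x , ⊕-new , e

  core-avoiding : ∀ {Y} → Core G′ Y → ¬ Y ∋ y → Core G Y
  core-avoiding {Y} (core b nx) ny = core b λ v p → let w , q , a = nx v p in w , q ,
    (case contract⁻ G a of λ { (_ , _ , inj₁ e) → e ; (_ , _ , inj₂ (e , _)) → contradiction (subst (Y ∋_) e q) ny })

  x∉core : ∀ {Y} → Core G′ Y → ¬ Y ∋ x
  x∉core c p = let _ , _ , a = Core.next c x p in proj₁ (contract⁻ G a) refl

  -- A core through `y` lifts by adding `x`, any other core is already one of `G`. Of two disjoint
  -- cores at most one contains `y`, so the lifts stay disjoint.
  contract-inter : Intercyclic G → Intercyclic G′
  contract-inter inter Y Z cY cZ dis with Y ∋? y | Z ∋? y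
  ... | yes y∈Y | _ = inter (Y ⊕ x) Z (core-through cY y∈Y) (core-avoiding cZ (dis y y∈Y)) λ v p q → case ⊕⁻ p of λ
        { (inj₁ r) → dis v r q ; (inj₂ refl) → x∉core cZ q }
  ... | no y∉Y | yes y∈Z = inter Y (Z ⊕ x) (core-avoiding cY y∉Y) (core-through cZ y∈Z) λ v p q → case ⊕⁻ q of λ
        { (inj₁ r) → dis v p r ; (inj₂ refl) → x∉core cY p }
  ... | no y∉Y | no y∉Z = inter Y Z (core-avoiding cY y∉Y) (core-avoiding cZ y∉Z) dis

  deg-contract : ∀ v → v ≢ x → deg G v ≤ suc (deg G′ v)
  deg-contract v ne = ≤-trans (count≤suc∖ (G v) x)
    (s≤s (count-mono λ w a → let b , q = ∖⁻ a in old⁺ ne q b))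

  -- Replacing the out-neighbour `x` by `y` costs something only if `y` was an out-neighbour before.
  deg-contract-uncommon : ∀ v → v ≢ x → ¬ (G v ∋ x × G v ∋ y) → deg G v ≤ deg G′ v
  deg-contract-uncommon v ne nc = case G v ∋? x of λ
    { (no nx) → count-mono λ w a → old⁺ ne (λ { refl → nx a }) a
    ; (yes a) → ≤-trans (count≤suc∖ (G v) x) (insert-count (new⁺ ne a) (count-mono λ w b →
        let c , q = ∖⁻ b in ∖⁺ (old⁺ ne q c) λ { refl → nc (a , c) })) }

  contract-positive : ∀ v → v ≢ x → 1 ≤ deg G v → 1 ≤ deg G′ v
  contract-positive v ne h = case G v ∋? x of λ
    { (no nx) → ≤-trans h (deg-contract-uncommon v ne λ { (a , _) → nx a })
    ; (yes a) → count-pos (new⁺ ne a) }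

-- Hub and rim

-- The vertices reachable from y along paths avoiding D; each comes with the vertex set of such a path.
record Reach (G : Digraph n) (D : VSet n) (y : Fin n) : Set where
  field
    N      : VSet n
    start  : N ∋ y
    avoids : ∀ v → N ∋ v → ¬ D ∋ v
    entry  : ∀ v → N ∋ v → v ≡ y ⊎ ∃[ u ] G u ∋ v
    closed : ∀ v w → N ∋ v → G v ∋ w → ¬ D ∋ w → N ∋ w
    path   : ∀ v → N ∋ v → ∃[ P ] (P ⊆ N × P ∋ y × P ∋ v × (∀ u → P ∋ u → u ≢ v → ∃[ w ] (P ∋ w × G u ∋ w)))

opaque
  reach : (G : Digraph n) (D : VSet n) (y : Fin n) → ¬ D ∋ y → Reach G D y
  reach {n} G D y y∉D = grow _ ⁅ y ⁆ ≤-refl ⁅⁆⁺ avoid₀ entry₀ path₀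
    where
    avoid₀ : ∀ v → ⁅ y ⁆ ∋ v → ¬ D ∋ v
    avoid₀ v p q = y∉D (subst (D ∋_) (⁅⁆⁻ p) q)
    entry₀ : ∀ v → ⁅ y ⁆ ∋ v → v ≡ y ⊎ ∃[ u ] G u ∋ v
    entry₀ v p = inj₁ (⁅⁆⁻ p)
    Path : VSet n → Fin n → Set
    Path N v = ∃[ P ] (P ⊆ N × P ∋ y × P ∋ v × (∀ u → P ∋ u → u ≢ v → ∃[ w ] (P ∋ w × G u ∋ w)))
    path₀ : ∀ v → ⁅ y ⁆ ∋ v → Path ⁅ y ⁆ v
    path₀ v p = ⁅ y ⁆ , (λ _ q → q) , ⁅⁆⁺ , p , λ u q ne → contradiction (trans (⁅⁆⁻ q) (sym (⁅⁆⁻ p))) ne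
    grow : ∀ k N → count {n} ((λ _ → true) ─ N) ≤ k → N ∋ y → (∀ v → N ∋ v → ¬ D ∋ v) →
           (∀ v → N ∋ v → v ≡ y ⊎ ∃[ u ] G u ∋ v) → (∀ v → N ∋ v → Path N v) → Reach G D y
    grow k N h y∈N av en pa
      with any? (λ v → any? λ w → (N ∋? v) ×-dec (G v ∋? w) ×-dec ¬? (D ∋? w) ×-dec ¬? (N ∋? w))
    ... | no none = record
      { N = N ; start = y∈N ; avoids = av ; entry = en ; path = pa
      ; closed = λ v w p a nd → decidable-stable (N ∋? w) λ nw → none (v , w , p , a , nd , nw) }
    grow zero N h y∈N av en pa | yes (v , w , p , a , nd , nw) =
      contradiction (≤-trans (count-pos (─⁺ {P = λ _ → true} (mem refl) nw)) h) λ ()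
    grow (suc k) N h y∈N av en pa | yes (v , w , p , a , nd , nw) =
      grow k (N ⊕ w) fewer (⊕-old y∈N) av′ en′ pa′
      where
      fewer : count ((λ _ → true) ─ (N ⊕ w)) ≤ k
      fewer = s≤s⁻¹ (≤-trans (count-mono-< {Q = (λ _ → true) ─ N}
        (λ x q → ─⁺ (mem refl) λ r → proj₂ (─⁻ q) (⊕-old r)) (─⁺ (mem refl) nw) λ q → proj₂ (─⁻ q) ⊕-new) h)
      av′ : ∀ x → (N ⊕ w) ∋ x → ¬ D ∋ x
      av′ x q with ⊕⁻ q
      ... | inj₁ r = av x r
      ... | inj₂ refl = nd
      en′ : ∀ x → (N ⊕ w) ∋ x → x ≡ y ⊎ ∃[ u ] G u ∋ x
      en′ x q with ⊕⁻ q
      ... | inj₁ r = en x r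
      ... | inj₂ refl = inj₂ (v , a)
      pa′ : ∀ x → (N ⊕ w) ∋ x → Path (N ⊕ w) x
      pa′ x q with ⊕⁻ q
      ... | inj₁ r = let P , s , t = pa x r in P , (λ z pz → ⊕-old (s z pz)) , t
      ... | inj₂ refl with pa v p
      ... | P , s , y∈P , v∈P , nx = P ⊕ w , sub , ⊕-old y∈P , ⊕-new , next′
        where
        sub : P ⊕ w ⊆ N ⊕ w
        sub z pz with ⊕⁻ pz
        ... | inj₁ r = ⊕-old (s z r)
        ... | inj₂ refl = ⊕-new
        next′ : ∀ u → (P ⊕ w) ∋ u → u ≢ w → ∃[ t ] ((P ⊕ w) ∋ t × G u ∋ t)
        next′ u pu ne with ⊕⁻ pu
        ... | inj₂ e = contradiction e ne
        ... | inj₁ r with u ≟ v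
        ... | yes refl = w , ⊕-new , a
        ... | no u≢v = let t , b , c = nx u r u≢v in t , ⊕-old b , c

-- Suppose no arc can be contracted for free: the ends of every arc have a common in-neighbour.
-- Relative to a hub y let N be reachable from y without using the in-neighbours of y,
-- let W be the rest, and let the rim S consist of the vertices of W that N dominates.
-- A path from y to s ∈ S inside N closes up through the arc s → y, so S lies on every cycle inside W.
module Hub {V : VSet n} {G : Digraph n} (wi : Within V G) (inter : Intercyclic G)
           (noloop : ∀ v → ¬ G v ∋ v)
           (out : ∀ v → V ∋ v → ∃[ w ] G v ∋ w)
           (into : ∀ v → V ∋ v → ∃[ u ] G u ∋ v)
           (common : ∀ x z → G x ∋ z → ∃[ u ] (G u ∋ x × G u ∋ z))
           {y : Fin n} (y∈V : V ∋ y) where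

  private
    R = reach G (In G y) y λ a → noloop y (In⁻ a)
    open Reach R

  opaque
    W : VSet n
    W = V ─ N

    W⁺ : ∀ {v} → V ∋ v → ¬ N ∋ v → W ∋ v
    W⁺ = ─⁺

    W⁻ : ∀ {v} → W ∋ v → V ∋ v × ¬ N ∋ v
    W⁻ = ─⁻

    S : VSet n
    S = comp λ c → (W ∋? c) ×-dec any? λ v → (N ∋? v) ×-dec (G v ∋? c)

    S⁺ : ∀ {c v} → W ∋ c → N ∋ v → G v ∋ c → S ∋ c
    S⁺ p q a = comp⁺ (p , _ , q , a)

    S⁻ : ∀ {c} → S ∋ c → W ∋ c × ∃[ v ] (N ∋ v × G v ∋ c)
    S⁻ = comp⁻

  y∉W : ¬ W ∋ y
  y∉W p = proj₂ (W⁻ p) start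

  dominator∈W : ∀ {v} → G v ∋ y → W ∋ v
  dominator∈W {v} a = W⁺ (proj₁ (wi v y a)) λ p → avoids v p (In⁺ a)

  S⊆W : S ⊆ W
  S⊆W s p = proj₁ (S⁻ p)

  -- An arc from `N` into a vertex outside `N` can only have been blocked because its head is an
  -- in-neighbour of `y`.
  rim→hub : ∀ s → S ∋ s → G s ∋ y
  rim→hub s p = let w , v , q , a = S⁻ p in decidable-stable (G s ∋? y) λ ns →
    proj₂ (W⁻ w) (closed v s q a λ b → ns (In⁻ b))

  into-W : ∀ {x u} → W ∋ x → ¬ S ∋ x → G u ∋ x → W ∋ u
  into-W {x} {u} p ns a = W⁺ (proj₁ (wi u x a)) λ q → ns (S⁺ p q a)

  -- If `x` dominates `y`, a common in-neighbour of the two also dominates `y` and hence lies in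
  -- `W`. If not, `x` is off the rim and receives no arc from `N`.
  pred-in-W : ∀ x → W ∋ x → ∃[ u ] (W ∋ u × G u ∋ x)
  pred-in-W x p with G x ∋? y
  ... | yes a = let u , b , c = common x y a in u , dominator∈W c , b
  ... | no na = let u , b = into x (proj₁ (W⁻ p)) in u , into-W p (λ q → na (rim→hub x q)) b , b

  core⊇S : ∀ {Y} → Core G Y → Y ⊆ W → S ⊆ Y
  core⊇S {Y} c Y⊆W s p = decidable-stable (Y ∋? s) contra
    where
    contra : ¬ ¬ Y ∋ s
    contra s∉Y with S⁻ p
    ... | _ , v , q , a with path v q
    ... | P , P⊆N , y∈P , v∈P , nx = inter (P ⊕ s) Y (core ⊕-new step) c λ z r t → case ⊕⁻ r of λ
        { (inj₁ z∈P) → proj₂ (W⁻ (Y⊆W z t)) (P⊆N z z∈P) ; (inj₂ refl) → s∉Y t }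
      where
      step : ∀ z → (P ⊕ s) ∋ z → ∃[ w ] ((P ⊕ s) ∋ w × G z ∋ w)
      step z r with ⊕⁻ r
      ... | inj₂ refl = y , ⊕-old y∈P , rim→hub s p
      ... | inj₁ z∈P with z ≟ v
      ... | yes refl = s , ⊕-new , a
      ... | no ne = let w , b , d = nx z z∈P ne in w , ⊕-old b , d

  inCore⊇S : ∀ {Y} → InCore G Y → Y ⊆ W → S ⊆ Y
  inCore⊇S ic s⊆ s p = let Z , c , t = InCore⇒Core ic in t s (core⊇S c (λ v q → s⊆ v (t v q)) s p)

  -- Otherwise `N` is a core, disjoint from the one that predecessors generate inside `W`. So some
  -- vertex of `N` sends all its arcs to `W`, and their heads are rim vertices.
  S-nonempty : ∃[ s ] S ∋ s
  S-nonempty with stuck? G N | into y y∈V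
  ... | no ns | u , a =
    let Z , c , t = InCore⇒Core (inCore (dominator∈W a) pred-in-W)
    in ⊥-elim (inter N Z (core start (unstuck ns)) c λ v p q → proj₂ (W⁻ (t v q)) p)
  ... | yes (v , p , dead) | _ with out v v∈V
    where
    v∈V : V ∋ v
    v∈V with entry v p
    ... | inj₁ refl = y∈V
    ... | inj₂ (u , a) = proj₂ (wi u v a)
  ... | w , a = w , S⁺ (W⁺ (proj₂ (wi v w a)) λ q → dead (w , q , a)) p a

  -- `W ∖ s` cannot be an in-core, as that would contain `s`; let `t` be a source of it. Then `s` is
  -- the only in-neighbour of `t` in `W`, so a common in-neighbour of `s` and `t` must lie in `N`,
  -- since there are no loops. This puts `t` on the rim.
  rim-succ : ∀ s → S ∋ s → ∃[ t ] (S ∋ t × G s ∋ t × (∀ u → W ∋ u → G u ∋ t → u ≡ s))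
  rim-succ s p with pred-in-W s (S⊆W s p)
  ... | q , q∈W , qs with sourceOrInCore G (W ∖ s) (∖⁺ q∈W λ { refl → noloop s qs })
  ... | inj₂ ic = contradiction refl (proj₂ (∖⁻ (inCore⊇S ic (∖-⊆ W s) s p)))
  ... | inj₁ (t , t∈ , src) = t , S⁺ t∈W v∈N vt , st , unique
    where
    t∈W = ∖-⊆ W s t t∈
    unique : ∀ u → W ∋ u → G u ∋ t → u ≡ s
    unique u r a = decidable-stable (u ≟ s) λ ne → src u (∖⁺ r ne) a
    st : G s ∋ t
    st = let u , r , a = pred-in-W t t∈W in subst (λ x → G x ∋ t) (unique u r a) a
    cm = common s t st
    v = proj₁ cm
    vt = proj₂ (proj₂ cm)
    v∈N : N ∋ v
    v∈N = decidable-stable (N ∋? v) λ nv → noloop s (subst (λ x → G x ∋ s)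
      (unique v (W⁺ (proj₁ (wi v t vt)) nv) vt) (proj₁ (proj₂ cm)))

  -- A rim vertex outside the image of rim-succ could be removed from S, leaving a cycle that misses it.
  rim-pred : ∀ s → S ∋ s → ∃[ p ] (S ∋ p × G p ∋ s × (∀ u → W ∋ u → G u ∋ s → u ≡ p))
  rim-pred s s∈S with any? (λ p → (S ∋? p) ×-dec (G p ∋? s) ×-dec
                       all? λ u → (W ∋? u) →-dec ((G u ∋? s) →-dec (u ≟ p)))
  ... | yes r = r
  ... | no none = contradiction refl (proj₂ (∖⁻ (core⊇S rest (λ v q → S⊆W v (∖-⊆ S s v q)) s s∈S)))
    where
    rest : Core G (S ∖ s)
    rest = core (let t , q , a , _ = rim-succ s s∈S in ∖⁺ q λ { e → noloop s (subst (G s ∋_) e a) }) λ v q →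
      let p = ∖-⊆ S s v q
          t , r , a , un = rim-succ v p
      in t , ∖⁺ r (λ { e → none (v , p , subst (G v ∋_) e a , λ u b c → un u b (subst (G u ∋_) (sym e) c)) }) , a

-- Minimal counterexamples

-- The case r = 1, s = 1 + σ in which (b) holds because at most 2s vertices have outdegree ≤ s + 1.
record Thick (σ : ℕ) (V : VSet n) (G : Digraph n) : Set where
  field
    within   : Within V G
    positive : ∀ v → V ∋ v → 1 ≤ deg G v
    low₁     : low# V G (1 + σ) ≤ σ
    large    : σ < count V
    low₂     : low# V G (2 + σ) ≤ σ + (2 + σ)

module Minimal {σ : ℕ} {V : VSet n} {G : Digraph n} (thick : Thick σ V G) (inter : Intercyclic G)
               (degree≤ : ∀ v → deg G v ≤ 3 + σ)
               (smaller : ∀ {σ′ V′ G′} → count V′ < count V → Thick σ′ V′ G′ → ¬ Intercyclic {n} G′) where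

  open Thick thick

  opaque
    noloop : ∀ v → ¬ G v ∋ v
    noloop = loopless within inter low₁ large

  large∖ : ∀ {x} → V ∋ x → σ < count (V ∖ x)
  large∖ x∈V = s≤s⁻¹ (subst (2 + σ ≤_) (count-∖ x∈V)
    (let v , _ , d = big-vertex (≤-<-trans low₁ large) in ≤-trans d (deg≤count within v)))

  fewer : ∀ {x} → V ∋ x → count (V ∖ x) < count V
  fewer x∈V = ≤-reflexive (sym (count-∖ x∈V))

  arc⇒≢ : ∀ {x y} → G x ∋ y → x ≢ y
  arc⇒≢ {x} a e = noloop x (subst (G x ∋_) (sym e) a)

  opaque
    out : ∀ v → V ∋ v → ∃[ w ] G v ∋ w
    out v p = count-pos⁻ (positive v p)

  -- The parameter `σ′` need not be `σ`: contracting an arc out of a vertex of low outdegree is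
  -- later tested against a parameter one smaller.
  not-contractible : ∀ {x y σ′} → G x ∋ y → low# (V ∖ x) (contract G x y) (1 + σ′) ≤ σ′ →
                     σ′ < count (V ∖ x) → ¬ low# (V ∖ x) (contract G x y) (2 + σ′) ≤ σ′ + (2 + σ′)
  not-contractible {x} {y} a l₁ lg l₂ = smaller (fewer (proj₁ (within x y a))) record
    { within = contract-within within a (arc⇒≢ a)
    ; positive = λ v p → let q , ne = ∖⁻ p in contract-positive within a (arc⇒≢ a) v ne (positive v q)
    ; low₁ = l₁ ; large = lg ; low₂ = l₂ } (contract-inter within a (arc⇒≢ a) inter)

  opaque
    common : ∀ x z → G x ∋ z → ∃[ u ] (G u ∋ x × G u ∋ z)
    common x z a with any? (λ u → (G u ∋? x) ×-dec (G u ∋? z))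
    ... | yes r = r
    ... | no none = ⊥-elim (not-contractible a (≤-trans (count-mono (sub _)) low₁)
                              (large∖ (proj₁ (within x z a))) (≤-trans (count-mono (sub _)) low₂))
      where
      sub : ∀ k → low (V ∖ x) (contract G x z) k ⊆ low V G k
      sub k v p = let q , d = low⁻ p ; r , ne = ∖⁻ q in
        low⁺ r (≤-trans (deg-contract-uncommon within a (arc⇒≢ a) v ne λ b → none (v , b)) d)

    -- Deleting a vertex without in-neighbours would lower no other outdegree, against minimality.
    into : ∀ z → V ∋ z → ∃[ u ] G u ∋ z
    into z z∈V with any? (λ u → G u ∋? z)
    ... | yes r = r
    ... | no none = ⊥-elim (smaller (fewer z∈V) record
        { within = delete-within within z
        ; positive = λ v p → let q , ne = ∖⁻ p in ≤-trans (positive v q) (same v ne)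
        ; low₁ = ≤-trans (count-mono (sub _)) low₁
        ; large = large∖ z∈V
        ; low₂ = ≤-trans (count-mono (sub _)) low₂ } (delete-inter within z inter))
      where
      same : ∀ v → v ≢ z → deg G v ≤ deg (delete G z) v
      same = deg-delete-unused within z λ u a → none (u , a)
      sub : ∀ k → low (V ∖ z) (delete G z) k ⊆ low V G k
      sub k v p = let q , d = low⁻ p ; r , ne = ∖⁻ q in low⁺ r (≤-trans (same v ne) d)

  -- The vertices of outdegree exactly `2 + σ`, that is s + 1.
  B : VSet n
  B = low V G (2 + σ) ─ low V G (1 + σ)

  low₁⊆low₂ : low V G (1 + σ) ⊆ low V G (2 + σ)
  low₁⊆low₂ v p = let a , b = low⁻ p in low⁺ a (≤-trans b (n≤1+n _))

  B∈V : ∀ {v} → B ∋ v → V ∋ v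
  B∈V p = proj₁ (low⁻ (proj₁ (─⁻ p)))

  -- Contracting b → y lowers only the outdegree of `u`, by at most one. If `u` is not in `B`, this
  -- brings no new vertex under `1 + σ`; under `2 + σ` at most `u` enters while `b` leaves. So the
  -- contraction would be a smaller counterexample.
  unique-common∈B : ∀ {b y u} → B ∋ b → G b ∋ y → (∀ v → G v ∋ b → G v ∋ y → v ≡ u) → B ∋ u
  unique-common∈B {b} {y} {u} b∈B a unique = decidable-stable (B ∋? u) λ u∉B →
    not-contractible a (≤-trans (count-mono (sub₁ u∉B)) low₁) (large∖ (B∈V b∈B))
      (≤-trans (count-mono sub₂) (≤-trans (count-⊕ _ u) (≤-trans (≤-reflexive (sym (count-∖ (proj₁ (─⁻ b∈B))))) low₂)))
    where
    G′ = contract G b y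
    compare : ∀ v → v ≢ b → v ≢ u → deg G v ≤ deg G′ v
    compare v ne nu = deg-contract-uncommon within a (arc⇒≢ a) v ne λ { (c , d) → nu (unique v c d) }
    sub₁ : ¬ B ∋ u → low (V ∖ b) G′ (1 + σ) ⊆ low V G (1 + σ)
    sub₁ u∉B v p with low⁻ p
    ... | q , d with ∖⁻ q
    ... | r , ne with v ≟ u
    ... | no nu = low⁺ r (≤-trans (compare v ne nu) d)
    ... | yes refl = decidable-stable (low V G (1 + σ) ∋? v) λ nl →
      u∉B (─⁺ (low⁺ r (≤-trans (deg-contract within a (arc⇒≢ a) v ne) (s≤s d))) nl)
    sub₂ : low (V ∖ b) G′ (2 + σ) ⊆ (low V G (2 + σ) ∖ b) ⊕ u
    sub₂ v p with low⁻ p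
    ... | q , d with ∖⁻ q
    ... | r , ne with v ≟ u
    ... | no nu = ⊕-old (∖⁺ (low⁺ r (≤-trans (compare v ne nu) d)) ne)
    ... | yes refl = ⊕-new

  module _ {y : Fin n} (y∈V : V ∋ y) where

    open Hub within inter noloop out into common y∈V

    -- For a member of `B` on the rim, its rim predecessor is its only common in-neighbour with `y`,
    -- so that predecessor is in `B` too. Hence a cycle runs inside the intersection of `B` and `S`,
    -- while `escape` makes the complement of this intersection a core.
    B∉S : (∀ v → V ∋ v → ¬ (B ∋ v × S ∋ v) → ∃[ w ] (G v ∋ w × ¬ (B ∋ w × S ∋ w))) → ∀ b → B ∋ b → ¬ S ∋ b
    B∉S escape b b∈B b∈S = inter (V ─ X) Z outer c λ v p q → proj₂ (─⁻ p) (Z⊆X v q)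
      where
      X : VSet n
      X = comp λ v → (B ∋? v) ×-dec (S ∋? v)
      cycle = InCore⇒Core {G = G} {X} (inCore (comp⁺ (b∈B , b∈S)) λ v p →
        let q , r = comp⁻ p
            u , u∈S , uv , unique = rim-pred v r
        in u , comp⁺ (unique-common∈B q (rim→hub v r) (λ w wv wy → unique w (dominator∈W wy) wv) , u∈S) , uv)
      Z = proj₁ cycle
      c = proj₁ (proj₂ cycle)
      Z⊆X = proj₂ (proj₂ cycle)
      outer : Core G (V ─ X)
      outer = core (─⁺ y∈V λ p → y∉W (S⊆W y (proj₂ (comp⁻ p)))) λ v p →
        let q , nx = ─⁻ p
            w , a , nw = escape v q λ r → nx (comp⁺ r)
        in w , ─⁺ (proj₂ (within v w a)) (λ r → nw (comp⁻ r)) , a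

    -- The in-neighbours of `x` all lie in `W`, and by `common` each of them has a predecessor among
    -- them. They form an in-core, which must contain the rim.
    rim-dominates : ∀ x → W ∋ x → ¬ S ∋ x → ∀ s → S ∋ s → G s ∋ x
    rim-dominates x x∈W x∉S s s∈S = In⁻ (inCore⊇S {Y = In G x}
      (inCore (let u , a = into x (proj₁ (W⁻ x∈W)) in In⁺ a) λ u p →
        let t , a , b = common u x (In⁻ p) in t , In⁺ b , a)
      (λ u p → into-W x∈W x∉S (In⁻ p)) s s∈S)

-- The case s ≥ 2

module _ {σ : ℕ} {V : VSet n} {G : Digraph n} (thick : Thick (suc σ) V G) (inter : Intercyclic G)
         (degree≤ : ∀ v → deg G v ≤ 4 + σ)
         (smaller : ∀ {σ′ V′ G′} → count V′ < count V → Thick σ′ V′ G′ → ¬ Intercyclic {n} G′)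
         (exact : low# V G (2 + σ) ≡ suc σ) where

  private
    open Thick thick
    open Minimal thick inter degree≤ smaller

    A : VSet n
    A = low V G (2 + σ)

    bound≡ : suc σ + (3 + σ) ≡ suc (suc (σ + (2 + σ)))
    bound≡ = cong suc (+-suc σ (2 + σ))

    module _ {x y : Fin n} (x∈A : A ∋ x) (xy : G x ∋ y) where

      private
        G′ = contract G x y

        sub₁ : low (V ∖ x) G′ (1 + σ) ⊆ A ∖ x
        sub₁ v p = let q , d = low⁻ p ; r , ne = ∖⁻ q in
          ∖⁺ (low⁺ r (≤-trans (deg-contract within xy (arc⇒≢ xy) v ne) (s≤s d))) ne

        sub₂ : low (V ∖ x) G′ (2 + σ) ⊆ low V G (3 + σ) ∖ x
        sub₂ v p = let q , d = low⁻ p ; r , ne = ∖⁻ q in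
          ∖⁺ (low⁺ r (≤-trans (deg-contract within xy (arc⇒≢ xy) v ne) (s≤s d))) ne

        impossible : ¬ low# (V ∖ x) G′ (2 + σ) ≤ σ + (2 + σ)
        impossible = not-contractible xy
          (≤-trans (count-mono sub₁) (∖-count x∈A (≤-reflexive exact)))
          (<-trans (n<1+n σ) (large∖ (proj₁ (low⁻ x∈A))))

      -- The contracted vertex `x` leaves `A`, so the first bound holds for parameter `σ`. The
      -- second would hold as well if the old count were below its maximum 2s.
      tight : suc σ + (3 + σ) ≤ low# V G (3 + σ)
      tight = ≮⇒≥ λ lt → impossible (≤-trans (count-mono sub₂)
        (∖-count (low₁⊆low₂ x x∈A) (s≤s⁻¹ (≤-trans lt (≤-reflexive bound≡)))))

      -- A member of `B` that misses an end of the arc keeps its outdegree `3 + σ`. Then both it and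
      -- `x` leave the low set, and the two places saved suffice for parameter `σ`.
      B-dominates-ends : ∀ b → B ∋ b → G b ∋ x × G b ∋ y
      B-dominates-ends b b∈B = decidable-stable ((G b ∋? x) ×-dec (G b ∋? y)) λ nb → impossible
        (≤-trans (count-mono (λ v p → ∖⁺ (sub₂ v p) λ { refl → keeps nb p }))
          (∖-count (∖⁺ b∈low b≢x) (∖-count (low₁⊆low₂ x x∈A) (≤-trans low₂ (≤-reflexive bound≡)))))
        where
        b∈low = proj₁ (─⁻ b∈B)
        b≢x : b ≢ x
        b≢x refl = proj₂ (─⁻ b∈B) x∈A
        keeps : ¬ (G b ∋ x × G b ∋ y) → ¬ low (V ∖ x) G′ (2 + σ) ∋ b
        keeps nb p = proj₂ (─⁻ b∈B) (low⁺ (B∈V b∈B)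
          (≤-trans (deg-contract-uncommon within xy (arc⇒≢ xy) b b≢x nb) (proj₂ (low⁻ p))))

  module _ {x y : Fin n} (x∈A : A ∋ x) (x→y : G x ∋ y) where

    private
      y∈V = proj₂ (within x y x→y)

      open Hub within inter noloop out into common y∈V

      B-size : count B + suc σ ≡ low# V G (3 + σ)
      B-size = trans (cong (count B +_) (sym exact)) (count-─ low₁⊆low₂)

      B≤ : count B ≤ 3 + σ
      B≤ = +-cancelˡ-≤ (suc σ) _ _ (≤-trans (≤-reflexive (trans (+-comm (suc σ) _) B-size)) low₂)

      B≥ : 3 + σ ≤ count B
      B≥ = +-cancelˡ-≤ (suc σ) _ _ (≤-trans (tight x∈A x→y) (≤-reflexive (trans (sym B-size) (+-comm _ (suc σ)))))

      y∉B : ¬ B ∋ y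
      y∉B p = noloop y (proj₂ (B-dominates-ends x∈A x→y y p))

      -- An arc from `A` into `B` would force a loop at its head, members of `B` point to `x`, and
      -- all others have outdegree above the size of `B`.
      escapeB : ∀ v → V ∋ v → ∃[ w ] (G v ∋ w × ¬ B ∋ w)
      escapeB v p with A ∋? v
      ... | yes v∈A = let w , a = out v p in w , a , λ q → noloop w (proj₂ (B-dominates-ends v∈A a w q))
      ... | no v∉A with B ∋? v
      ... | yes v∈B = x , proj₁ (B-dominates-ends x∈A x→y v v∈B) , λ q → proj₂ (─⁻ q) x∈A
      ... | no v∉B = count<⇒∃ {P = B} {G v} (≤-trans (s≤s B≤) (≰⇒> λ d → v∉B (─⁺ (low⁺ p d) v∉A)))

    B∩S : ∀ b → B ∋ b → ¬ S ∋ b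
    B∩S = B∉S y∈V λ v p _ → let w , a , nb = escapeB v p in w , a , λ { (b , _) → nb b }

    -- The vertices of `B` dominate `y` but are off the rim, so `s` dominates them all. With `y` and
    -- `s′` this gives `5 + σ` out-neighbours.
    rim-degree : ∀ {s s′} → S ∋ s → S ∋ s′ → G s ∋ s′ → ⊥
    rim-degree {s} {s′} s∈S s′∈S a = 1+n≰n (≤-trans (s≤s (s≤s B≥)) (≤-trans (s≤s (count-⊕-new y∉B))
      (≤-trans (count-⊕-new s′∉) (≤-trans (count-mono many) (degree≤ s)))))
      where
      many : (B ⊕ y) ⊕ s′ ⊆ G s
      many v p with ⊕⁻ p
      ... | inj₂ refl = a
      ... | inj₁ q with ⊕⁻ q
      ... | inj₂ refl = rim→hub s s∈S
      ... | inj₁ v∈B = rim-dominates y∈V v (dominator∈W (proj₂ (B-dominates-ends x∈A x→y v v∈B))) (B∩S v v∈B) s s∈S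
      s′∉ : ¬ (B ⊕ y) ∋ s′
      s′∉ p with ⊕⁻ p
      ... | inj₁ q = B∩S s′ q s′∈S
      ... | inj₂ refl = y∉W (S⊆W s′ s′∈S)

    no-short-arc : ⊥
    no-short-arc = let s , p = S-nonempty ; t , q , a , _ = rim-succ s p in rim-degree p q a

  thick-suc-impossible : ⊥
  thick-suc-impossible =
    let x , x∈A = count-pos⁻ (subst (1 ≤_) (sym exact) (s≤s z≤n))
        y , a = out x (proj₁ (low⁻ x∈A))
    in no-short-arc x∈A a

-- The case s = 1

module _ {V : VSet n} {G : Digraph n} (thick : Thick 0 V G) (inter : Intercyclic G)
         (degree≤ : ∀ v → deg G v ≤ 3)
         (smaller : ∀ {σ′ V′ G′} → count V′ < count V → Thick σ′ V′ G′ → ¬ Intercyclic {n} G′)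
         {b y : Fin n} (b∈low : low V G 2 ∋ b) (b→y : G b ∋ y) where

  private
    open Thick thick
    open Minimal thick inter degree≤ smaller

    none-low : ∀ v → ¬ low V G 1 ∋ v
    none-low v p = contradiction (≤-trans (count-pos p) low₁) λ ()

    b∈B : B ∋ b
    b∈B = ─⁺ b∈low (none-low b)

    y∈V = proj₂ (within b y b→y)

    open Hub within inter noloop out into common y∈V

    X : VSet n
    X = comp λ v → (B ∋? v) ×-dec (S ∋? v)

    X⊆low : X ⊆ low V G 2
    X⊆low v p = proj₁ (─⁻ (proj₁ (comp⁻ p)))

    -- At most two vertices have outdegree 2 and none has less. A vertex of outdegree 2 outside `X`
    -- leaves at most one member for `X`; any other vertex has three out-neighbours against two.
    escapeX : ∀ v → V ∋ v → ¬ (B ∋ v × S ∋ v) → ∃[ w ] (G v ∋ w × ¬ (B ∋ w × S ∋ w))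
    escapeX v p nx with low V G 2 ∋? v
    ... | no v∉ = let w , a , nw = count<⇒∃ {P = X} {G v} (≤-trans (s≤s (≤-trans (count-mono X⊆low) low₂)) (≰⇒> λ d → v∉ (low⁺ p d)))
                  in w , a , λ r → nw (comp⁺ r)
    ... | yes v∈ = let w , a , nw = count<⇒∃ {P = X} {G v} (≤-trans (count-⊕-new λ r → nx (comp⁻ r))
                        (≤-trans (count-mono {P = X ⊕ v} λ u q → case ⊕⁻ q of λ { (inj₁ r) → X⊆low u r ; (inj₂ refl) → v∈ })
                          (≤-trans low₂ (≰⇒> λ d → none-low v (low⁺ p d)))))
                  in w , a , λ r → nw (comp⁺ r)

    b∉S : ¬ S ∋ b
    b∉S = B∉S y∈V escapeX b b∈B

    b∈W : (W ─ S) ∋ b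
    b∈W = ─⁺ (dominator∈W b→y) b∉S

  -- `W ─ S` has a source `x`, and `x` has an out-neighbour `z` other than `y`. A common
  -- in-neighbour `u` of `x` and `z` must be on the rim, so it dominates `x`, `z`, `y` and its rim
  -- successor. These are four vertices: the rim successor has its only in-neighbour from `W` on the
  -- rim, so it is not `z`.
  thick-zero-impossible : ⊥
  thick-zero-impossible with sourceOrInCore G (W ─ S) b∈W
  ... | inj₂ ic = let s , p = S-nonempty in proj₂ (─⁻ (inCore⊇S ic (λ v q → proj₁ (─⁻ q)) s p)) p
  ... | inj₁ (x , x∈ , source) =
    1+n≰n (≤-trans (insert-count ux (insert-count (∖⁺ uz (≢-sym x≢z))
      (insert-count (∖⁺ (∖⁺ (rim→hub u u∈S) y≢x) (≢-sym z≢y))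
        (count-pos (∖⁺ (∖⁺ (∖⁺ us′ (λ e → x∉S (subst (S ∋_) e s′∈S))) (λ e → z≢s′ (sym e))) s′≢y))))) (degree≤ u))
    where
    x∈W = proj₁ (─⁻ x∈)
    x∉S = proj₂ (─⁻ x∈)
    y≢x : y ≢ x
    y≢x e = y∉W (subst (W ∋_) (sym e) x∈W)
    zs = count-pos⁻ {P = G x ∖ y} (s≤s⁻¹ (≤-trans (≰⇒> λ d → none-low x (low⁺ (proj₁ (W⁻ x∈W)) d)) (count≤suc∖ (G x) y)))
    z = proj₁ zs
    xz = proj₁ (∖⁻ (proj₂ zs))
    z≢y = proj₂ (∖⁻ (proj₂ zs))
    x≢z = arc⇒≢ xz
    cm = common x z xz
    u = proj₁ cm
    ux = proj₁ (proj₂ cm)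
    uz = proj₂ (proj₂ cm)
    u∈S : S ∋ u
    u∈S = decidable-stable (S ∋? u) λ nu → source u (─⁺ (into-W x∈W x∉S ux) nu) ux
    sc = rim-succ u u∈S
    s′ = proj₁ sc
    s′∈S = proj₁ (proj₂ sc)
    us′ = proj₁ (proj₂ (proj₂ sc))
    z≢s′ : z ≢ s′
    z≢s′ e = let p , p∈S , _ , unique = rim-pred s′ s′∈S in
      x∉S (subst (S ∋_) (sym (unique x x∈W (subst (G x ∋_) e xz))) p∈S)
    s′≢y : s′ ≢ y
    s′≢y e = y∉W (S⊆W y (subst (S ∋_) e s′∈S))

-- Trimming outdegrees and the induction

prune : (Fin n → ℕ) → Digraph n → Digraph n
prune t G v = take (t v) (G v)

prune-⊆ : (t : Fin n → ℕ) (G : Digraph n) → ∀ v → prune t G v ⊆ G v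
prune-⊆ t G v = take-⊆ (t v) (G v)

-- A vertex whose trimmed outdegree stays below its bound `t v` has lost no arc.
deg-prune : (t : Fin n → ℕ) (G : Digraph n) {v : Fin n} {k : ℕ} → k < t v → deg (prune t G) v ≤ k → deg G v ≤ k
deg-prune t G {v} {k} lt d with ≤-total (t v) (deg G v)
... | inj₁ h = contradiction (≤-trans lt (≤-trans (≤-reflexive (sym (count-take (t v) (G v) h))) d)) 1+n≰n
... | inj₂ h = ≤-trans (count-mono (take-all (t v) (G v) h)) d

module _ {σ : ℕ} {V : VSet n} {G : Digraph n} (thick : Thick σ V G) (t : Fin n → ℕ) where

  open Thick thick

  prune-low : ∀ {k} → (∀ v → k < t v) → low V (prune t G) k ⊆ low V G k
  prune-low h v p = let q , d = low⁻ p in low⁺ q (deg-prune t G (h v) d)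

  low-prune : ∀ k → low V G k ⊆ low V (prune t G) k
  low-prune k v p = let q , d = low⁻ p in low⁺ q (≤-trans (count-mono (prune-⊆ t G v)) d)

  prune-thick : (∀ v → 1 + σ < t v) → low# V (prune t G) (2 + σ) ≤ σ + (2 + σ) → Thick σ V (prune t G)
  prune-thick h l₂ = record
    { within = λ u w a → within u w (prune-⊆ t G u w a)
    ; positive = λ v p → ≮⇒≥ λ lt → contradiction
        (≤-trans (positive v p) (deg-prune t G (<-trans (s≤s z≤n) (h v)) (s≤s⁻¹ lt))) λ ()
    ; low₁ = ≤-trans (count-mono (prune-low h)) low₁
    ; large = large
    ; low₂ = l₂ }

-- Inside the induction on the number of vertices, `σ` descends until the first bound is attained
-- with equality or `σ` is 0. Trimming to s + 2 supplies `degree≤`.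
thick-step : ∀ k → (∀ σ {V : VSet n} {G : Digraph n} → count V ≤ k → Thick σ V G → ¬ Intercyclic G) →
             ∀ σ {V : VSet n} {G : Digraph n} → count V ≤ suc k → Thick σ V G → ¬ Intercyclic G
thick-step k ih zero {V} {G} h thick inter with any? (low V G 2 ∋?_)
... | yes (b , b∈low) =
  let thick′ = prune-thick thick (λ _ → 3) (λ _ → s≤s (s≤s z≤n)) (≤-trans (count-mono (prune-low thick (λ _ → 3) λ _ → ≤-refl)) (Thick.low₂ thick))
      b∈low′ = low-prune thick (λ _ → 3) 2 b b∈low
      y , a = count-pos⁻ (Thick.positive thick′ b (proj₁ (low⁻ b∈low)))
  in thick-zero-impossible thick′ (Intercyclic-⊆ (prune-⊆ (λ _ → 3) G) inter)
       (λ v → count-take-≤ 3 (G v)) (λ lt → ih _ (s≤s⁻¹ (≤-trans lt h))) b∈low′ a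
... | no none =
  let v₀ , v₀∈V = count-pos⁻ (Thick.large thick) in pruned v₀ v₀∈V
  where
  pruned : ∀ v₀ → V ∋ v₀ → ⊥
  pruned v₀ v₀∈V =
    let y , a = count-pos⁻ (Thick.positive thick′ v₀ v₀∈V)
    in thick-zero-impossible thick′ (Intercyclic-⊆ (prune-⊆ t G) inter)
       (λ v → ≤-trans (count-take-≤ (t v) (G v)) (t≤3 v)) (λ lt → ih _ (s≤s⁻¹ (≤-trans lt h)))
       (low⁺ v₀∈V (≤-trans (count-take-≤ (t v₀) (G v₀)) (≤-reflexive t₀))) a
    where
    t : Fin _ → ℕ
    -- No vertex has outdegree at most 2 here, so an arbitrary one is trimmed to 2; it becomes the
    -- only such vertex.
    t v = if does (v ≟ v₀) then 2 else 3
    t≤3 : ∀ v → t v ≤ 3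
    t≤3 v with v ≟ v₀
    ... | yes _ = s≤s (s≤s z≤n)
    ... | no _  = ≤-refl
    2≤t : ∀ v → 2 ≤ t v
    2≤t v with v ≟ v₀
    ... | yes _ = ≤-refl
    ... | no _  = s≤s (s≤s z≤n)
    t₀ : t v₀ ≡ 2
    t₀ with v₀ ≟ v₀
    ... | yes _ = refl
    ... | no ne = contradiction refl ne
    t≢₀ : ∀ v → v ≢ v₀ → t v ≡ 3
    t≢₀ v ne with v ≟ v₀
    ... | yes e = contradiction e ne
    ... | no _  = refl
    only : low V (prune t G) 2 ⊆ ⁅ v₀ ⁆
    only v p = decidable-stable (⁅ v₀ ⁆ ∋? v) λ nv →
      none (v , low⁺ (proj₁ (low⁻ p)) (deg-prune t G
        (≤-reflexive (sym (t≢₀ v λ { refl → nv ⁅⁆⁺ }))) (proj₂ (low⁻ p))))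
    thick′ : Thick 0 V (prune t G)
    thick′ = prune-thick thick t 2≤t (≤-trans (count-mono only) (≤-trans (≤-reflexive (count-⁅⁆ v₀)) (s≤s z≤n)))
thick-step k ih (suc σ) {V} {G} h thick inter with low# V G (2 + σ) ≤? σ
-- This single count bounds both low sets for parameter `σ`.
... | yes few = thick-step k ih σ h record
    { within = within ; positive = positive
    ; low₁ = ≤-trans (low-mono (n≤1+n _)) few
    ; large = <-trans (n<1+n σ) large
    ; low₂ = ≤-trans few (m≤m+n σ _) } inter
  where open Thick thick
... | no many = thick-suc-impossible thick′ (Intercyclic-⊆ (prune-⊆ (λ _ → 4 + σ) G) inter)
    (λ v → count-take-≤ (4 + σ) (G v)) (λ lt → ih _ (s≤s⁻¹ (≤-trans lt h)))
    (≤-antisym (Thick.low₁ thick′) (≤-trans (≰⇒> many) (count-mono (low-prune thick (λ _ → 4 + σ) (2 + σ)))))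
  where
  thick′ : Thick (suc σ) V (prune (λ _ → 4 + σ) G)
  thick′ = prune-thick thick (λ _ → 4 + σ) (λ _ → n≤1+n _)
    (≤-trans (count-mono (prune-low thick (λ _ → 4 + σ) λ _ → ≤-refl)) (Thick.low₂ thick))

thick⇒¬intercyclic : ∀ k σ {V : VSet n} {G : Digraph n} → count V ≤ k → Thick σ V G → ¬ Intercyclic G
thick⇒¬intercyclic zero σ h thick inter = contradiction (≤-trans (s≤s z≤n) (≤-trans (Thick.large thick) h)) λ ()
thick⇒¬intercyclic (suc k) = thick-step k (thick⇒¬intercyclic k)

-- Condition (b) through an index j

-- Here `i` stands for j - 1. Each contraction lowers `i` by one; once it reaches `σ + (2 + σ)`, the
-- bound on `low# V G i` implies `low₂`.
¬intercyclic-high : ∀ i σ {V : VSet n} {G : Digraph n} → Within V G → (∀ v → V ∋ v → 1 ≤ deg G v) →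
                    low# V G (1 + σ) ≤ σ → σ < count V → σ + (3 + σ) ≤ i → i < count V → low# V G i ≤ i →
                    ¬ Intercyclic G
¬intercyclic-high {n} i σ {V} {G} wi pos lo big si i<V lowi inter with any? (low V G i ∋?_)
... | no none = thick⇒¬intercyclic (count V) σ ≤-refl record
    { within = wi ; positive = pos ; low₁ = lo ; large = big
    ; low₂ = ≤-trans (≤-reflexive (count-empty λ v p → none (v , low⁺ (proj₁ (low⁻ p))
        (≤-trans (proj₂ (low⁻ p)) (≤-trans (≤-trans (n≤1+n _) (m≤n+m _ σ)) si))))) z≤n } inter
... | yes (x₀ , x₀∈L) = let y , a = count-pos⁻ (pos x₀ (proj₁ (low⁻ x₀∈L))) in go y a
  where
  L = low V G i
  noloop = loopless wi inter lo big
  go : ∀ y → G x₀ ∋ y → ⊥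
  go y x₀y with sourceOrInCore G U (comp⁺ (x₀∈L , x₀y))
    where
    U : VSet n
    U = comp λ u → (L ∋? u) ×-dec (G u ∋? y)
  -- A cycle `Q` inside `L` is enclosed up to `suc i` vertices. Those added have outdegree at most
  -- `i`, so `L` would have more than `i` members.
  ... | inj₂ ic = 1+n≰n (≤-trans (≤-trans (≤-reflexive (sym size)) (count-mono inside)) lowi)
    where
    cycle = InCore⇒Core ic
    Q = proj₁ cycle
    Q⊆L : Q ⊆ L
    Q⊆L v p = proj₁ (comp⁻ (proj₂ (proj₂ cycle) v p))
    Q≤ : count Q ≤ suc i
    Q≤ = ≤-trans (count-mono Q⊆L) (≤-trans lowi (n≤1+n i))
    split : suc i ∸ count Q + count Q ≡ suc i
    split = trans (+-comm (suc i ∸ count Q) _) (m+[n∸m]≡n Q≤)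
    enc = enclose wi (λ v p → proj₁ (low⁻ (Q⊆L v p)))
            (λ Y c dis → inter Y Q c (proj₁ (proj₂ cycle)) dis) (suc i ∸ count Q) (≤-trans (≤-reflexive split) i<V)
    Z = proj₁ enc
    size : count Z ≡ suc i
    size = trans (proj₁ (proj₂ (proj₂ enc))) split
    inside : Z ⊆ L
    inside v p with Q ∋? v
    ... | yes q = Q⊆L v q
    ... | no nq = let q , d = proj₂ (proj₂ (proj₂ enc)) v p nq in
      low⁺ q (s≤s⁻¹ (≤-trans d (≤-reflexive split)))
  ... | inj₁ (x , x∈U , source) = descend i si i<V lowi (proj₁ (comp⁻ x∈U)) λ u u∈L uy → source u (comp⁺ (u∈L , uy))
    where
    xy = proj₂ (comp⁻ x∈U)
    x≢y : x ≢ y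
    x≢y e = noloop x (subst (G x ∋_) (sym e) xy)
    descend : ∀ i → σ + (3 + σ) ≤ i → i < count V → low# V G i ≤ i → low V G i ∋ x →
              (∀ u → low V G i ∋ u → G u ∋ y → ¬ G u ∋ x) → ⊥
    descend zero si = contradiction (≤-trans (≤-trans (s≤s z≤n) (m≤n+m (3 + σ) σ)) si) λ ()
    descend (suc j) si j<V lowj x∈L source′ = finish (m≤n⇒m<n∨m≡n si)
      where
      G′ = contract G x y
      V′ = V ∖ x
      sizeV : count V ≡ suc (count V′)
      sizeV = count-∖ (proj₁ (low⁻ x∈L))
      wi′ = contract-within wi xy x≢y
      pos′ : ∀ v → V′ ∋ v → 1 ≤ deg G′ v
      pos′ v p = let q , ne = ∖⁻ p in contract-positive wi xy x≢y v ne (pos v q)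
      -- A vertex of new outdegree at most `j` had at most `suc j` before. So `source′` applies: it
      -- was no common in-neighbour and lost nothing.
      sub : ∀ k → k ≤ j → low V′ G′ k ⊆ low V G k ∖ x
      sub k k≤j v p = let q , d = low⁻ p ; r , ne = ∖⁻ q in
        ∖⁺ (low⁺ r (≤-trans (deg-contract-uncommon wi xy x≢y v ne λ { (vx , vy) →
          source′ v (low⁺ r (≤-trans (deg-contract wi xy x≢y v ne) (s≤s (≤-trans d k≤j)))) vy vx }) d)) ne
      lo′ : ∀ k → k ≤ j → low# V′ G′ k ≤ low# V G k
      lo′ k h = ≤-trans (count-mono (sub k h)) (count-mono (∖-⊆ _ x))
      j′ : low# V′ G′ j ≤ j
      j′ = ≤-trans (count-mono λ v p → let q , ne = ∖⁻ (sub j ≤-refl v p) ; r , d = low⁻ q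
             in ∖⁺ (low⁺ {V = V} {G} r (≤-trans d (n≤1+n j))) ne) (∖-count x∈L lowj)
      2+2σ≤j : σ + (2 + σ) ≤ j
      2+2σ≤j = s≤s⁻¹ (≤-trans (≤-reflexive (sym (+-suc σ (2 + σ)))) si)
      2+σ≤j : 2 + σ ≤ j
      2+σ≤j = ≤-trans (m≤n+m _ σ) 2+2σ≤j
      lo₁ : low# V′ G′ (1 + σ) ≤ σ
      lo₁ = ≤-trans (lo′ (1 + σ) (≤-trans (n≤1+n _) 2+σ≤j)) lo
      big′ : σ < count V′
      big′ = s≤s⁻¹ (≤-trans (s≤s (≤-trans (≤-trans (n≤1+n _) 2+σ≤j) (n≤1+n j))) (≤-trans j<V (≤-reflexive sizeV)))
      inter′ = contract-inter wi xy x≢y inter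
      finish : σ + (3 + σ) < suc j ⊎ σ + (3 + σ) ≡ suc j → ⊥
      finish (inj₁ lt) = ¬intercyclic-high j σ wi′ pos′ lo₁ big′ (s≤s⁻¹ lt)
        (s≤s⁻¹ (≤-trans j<V (≤-reflexive sizeV))) j′ inter′
      finish (inj₂ e) = thick⇒¬intercyclic (count V′) σ ≤-refl record
        { within = wi′ ; positive = pos′ ; low₁ = lo₁ ; large = big′
        ; low₂ = ≤-trans (low-mono 2+σ≤j) (≤-trans j′ (≤-reflexive
            (suc-injective (trans (sym e) (+-suc σ (2 + σ)))))) } inter′

-- Reduction to r = 1

minimum : (Y : VSet n) (f : Fin n → ℕ) {v : Fin n} → Y ∋ v → ∃[ x ] (Y ∋ x × (∀ u → Y ∋ u → f x ≤ f u))
minimum Y f {v} p = go v p (<-wellFounded (f v))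
  where
  go : ∀ v → Y ∋ v → Acc _<_ (f v) → ∃[ x ] (Y ∋ x × (∀ u → Y ∋ u → f x ≤ f u))
  go v p (acc rs) with any? (λ u → (Y ∋? u) ×-dec (f u <? f v))
  ... | yes (u , q , lt) = go u q (rs lt)
  ... | no none = v , p , λ u q → ≮⇒≥ λ lt → none (u , q , lt)

-- With r = 1 + ρ and s = 1 + ρ + τ these are the conditions of largeness in terms of the numbers of vertices of low outdegree.
large⇒¬intercyclic : ∀ ρ τ {V : VSet n} {G : Digraph n} → Within V G → low# V G ρ ≤ ρ →
  low# V G (1 + (ρ + τ)) ≤ ρ + τ → ρ + τ < count V →
  low# V G (2 + (ρ + τ)) ≤ ρ + (τ + (2 + τ)) ⊎ ∃[ i ] (ρ + (τ + (3 + τ)) ≤ i × i < count V × low# V G i ≤ i) →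
  ¬ Intercyclic G
large⇒¬intercyclic zero τ {V} {G} wi l₀ l₁ big l₂ = case l₂ of λ
  { (inj₁ h) → thick⇒¬intercyclic (count V) τ ≤-refl record
      { within = wi ; positive = positive ; low₁ = l₁ ; large = big ; low₂ = h }
  ; (inj₂ (i , τ≤i , i<V , h)) → ¬intercyclic-high i τ wi positive l₁ big τ≤i i<V h }
  where
  positive : ∀ v → V ∋ v → 1 ≤ deg G v
  positive v p = ≰⇒> λ d → contradiction (≤-trans (count-pos (low⁺ {V = V} {G} p d)) l₀) λ ()
large⇒¬intercyclic (suc ρ) τ {V} {G} wi l₀ l₁ big l₂ inter with count-pos⁻ (≤-trans (s≤s z≤n) big)
... | v₀ , v₀∈V with minimum V (deg G) v₀∈V
... | x , x∈V , least = large⇒¬intercyclic ρ τ (delete-within wi x) (drop l₀) (drop l₁) (small big)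
    (case l₂ of λ { (inj₁ h) → inj₁ (drop h) ; (inj₂ r) → inj₂ (shift r) }) (delete-inter wi x inter)
  where
  G′ = delete G x
  drop : ∀ {k m} → low# V G (suc k) ≤ suc m → low# (V ∖ x) G′ k ≤ m
  -- If the deleted vertex `x` is not in `low V G (suc k)`, minimality of its outdegree makes that
  -- set empty; otherwise the set loses `x`.
  drop {k} {m} h = ≤-trans (count-mono sub) (case low V G (suc k) ∋? x of λ
    { (yes p) → ∖-count p h
    ; (no np) → ≤-trans (≤-reflexive (count-empty λ v p → let q , d = low⁻ (∖-⊆ _ x v p) in
        np (low⁺ x∈V (≤-trans (least v q) d)))) z≤n })
    where
    sub : low (V ∖ x) G′ k ⊆ low V G (suc k) ∖ x
    sub v p = let q , d = low⁻ p ; r , ne = ∖⁻ q in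
      ∖⁺ (low⁺ r (≤-trans (deg-delete wi x v ne) (s≤s d))) ne
  small : ∀ {m} → suc m < count V → m < count (V ∖ x)
  small h = s≤s⁻¹ (≤-trans h (≤-reflexive (count-∖ x∈V)))
  shift : ∃[ i ] (suc ρ + (τ + (3 + τ)) ≤ i × i < count V × low# V G i ≤ i) →
          ∃[ i ] (ρ + (τ + (3 + τ)) ≤ i × i < count (V ∖ x) × low# (V ∖ x) G′ i ≤ i)
  shift (suc i , h , i<V , l) = i , s≤s⁻¹ h , small i<V , drop l

-- From cores to cycles as lists

-- Disjoint cores are separated by some subset and its complement. There are finitely many subsets,
-- and `hasCore?` decides each side.
nonintercyclic⇒cores : {G : Digraph n} → ¬ Intercyclic G →
  ∃[ Y ] ∃[ Z ] (Core G Y × Core G Z × (∀ v → Y ∋ v → ¬ Z ∋ v))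
nonintercyclic⇒cores {n} {G} ni with anySubset? (λ p →
    hasCore? G (lookup p) ×-dec hasCore? G (comp λ v → ¬? (lookup p ∋? v)))
... | yes (p , (Y , cY , sY) , (Z , cZ , sZ)) = Y , Z , cY , cZ , λ v y z → comp⁻ (sZ v z) (sY v y)
... | no none = ⊥-elim (ni λ Y Z cY cZ dis → none (V.tabulate Y
    , (Y , cY , λ v y → mem (trans (lookup∘tabulate Y v) (holds y)))
    , (Z , cZ , λ v z → comp⁺ λ y → dis v (mem (trans (sym (lookup∘tabulate Y v)) (holds y))) z)))

prefix : {A : Set} {x : A} {xs : List A} → x ∈ xs → List A
prefix {x = x} (here _) = x ∷ []
prefix {xs = y ∷ _} (there p) = y ∷ prefix p

prefix-⊆ : {A : Set} {x : A} {xs : List A} (p : x ∈ xs) → ∀ {v} → v ∈ prefix p → v ∈ xs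
prefix-⊆ (here e) (here refl) = here e
prefix-⊆ (there p) (here e) = here e
prefix-⊆ (there p) (there q) = there (prefix-⊆ p q)

prefix-unique : {A : Set} {x : A} {xs : List A} (p : x ∈ xs) → Unique xs → Unique (prefix p)
prefix-unique (here _) _ = [] ∷ []
prefix-unique (there p) (d ∷ u) = All.tabulate (λ q → All.lookup d (prefix-⊆ p q)) ∷ prefix-unique p u

prefix-linked : {A : Set} {R : A → A → Set} {x z : A} {xs : List A} (p : x ∈ xs) → Linked R xs → R x z →
                Linked R (prefix p ++ z ∷ [])
prefix-linked (here refl) _ r = r ∷ [-]
prefix-linked (there (here refl)) (a ∷ _) r = a ∷ r ∷ [-]
prefix-linked (there (there p)) (a ∷ l) r = a ∷ prefix-linked (there p) l r

prefix-head : {A : Set} {x y : A} {xs : List A} (p : x ∈ y ∷ xs) → ∃[ ys ] prefix p ≡ y ∷ ys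
prefix-head (here refl) = [] , refl
prefix-head (there p) = prefix p , refl

-- Predecessors are prepended, so the list always follows the arcs. When one repeats, the prefix
-- ending in it closes up to a cycle; `X` holds the unvisited vertices.
InCore⇒cycle : {G : Digraph n} {Y : VSet n} → InCore G Y → ∃[ c ] (IsCycle G c × (∀ v → v ∈ c → Y ∋ v))
InCore⇒cycle {n} {G} {Y} (inCore {y} y∈Y prev) =
  walk (count Y) Y y [] ≤-refl (λ _ p _ → p) ([] ∷ []) [-] (λ { _ (here refl) → y∈Y })
  where
  walk : ∀ k (X : VSet n) x xs → count X ≤ k → (∀ v → Y ∋ v → ¬ v ∈ x ∷ xs → X ∋ v) →
         Unique (x ∷ xs) → Linked (Arc G) (x ∷ xs) → (∀ v → v ∈ x ∷ xs → Y ∋ v) →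
         ∃[ c ] (IsCycle G c × (∀ v → v ∈ c → Y ∋ v))
  walk k X x xs h rest u l inY with prev x (inY x (here refl))
  ... | w , w∈Y , mem a with w ∈? (x ∷ xs)
  ... | yes p with prefix-head p | prefix-unique p u | prefix-linked p l a | prefix-⊆ p
  ... | ys , e | u′ | l′ | s rewrite e = x ∷ ys , (u′ , l′) , λ v q → inY v (s q)
  walk zero X x xs h rest u l inY | w , w∈Y , _ | no np = contradiction (≤-trans (count-pos (rest w w∈Y np)) h) λ ()
  walk (suc k) X x xs h rest u l inY | w , w∈Y , mem a | no np =
    walk k (X ∖ w) w (x ∷ xs) (∖-count (rest w w∈Y np) h)
      (λ v p nv → ∖⁺ (rest v p λ r → nv (there r)) λ e → nv (here e))
      (All.tabulate (λ q e → np (subst (_∈ x ∷ xs) (sym e) q)) ∷ u) (a ∷ l)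
      (λ { v (here refl) → w∈Y ; v (there r) → inY v r })

-- A core is an in-core of the reversed digraph. A core found in it there is an in-core of `G`,
-- ready for the backward walk.
Core⇒cycle : {G : Digraph n} {Y : VSet n} → Core G Y → ∃[ c ] (IsCycle G c × (∀ v → v ∈ c → Y ∋ v))
Core⇒cycle {G = G} (core y next) =
  let Z , core z prev , s = InCore⇒Core {G = λ u v → G v u} (inCore y λ v p → let w , q , a = next v p in w , q , mem (holds a))
      c , isc , t = InCore⇒cycle {G = G} {Z} (inCore z λ v p → let w , q , a = prev v p in w , q , mem (holds a))
  in c , isc , λ v p → s v (t v p)

disjoint-cycles : {G : Digraph n} → ¬ Intercyclic G → HasTwoDisjointCycles G
disjoint-cycles ni =
  let Y , Z , cY , cZ , dis = nonintercyclic⇒cores ni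
      c₁ , i₁ , s₁ = Core⇒cycle cY
      c₂ , i₂ , s₂ = Core⇒cycle cZ
  in c₁ , c₂ , i₁ , i₂ , λ v p q → dis v (s₁ v p) (s₂ v q)

cycle⇒Core : {G : Digraph n} (c : List (Fin n)) → IsCycle G c → ∃[ Y ] (Core G Y × (∀ v → Y ∋ v → v ∈ c))
cycle⇒Core {n} {G} (x ∷ xs) (_ , l) = comp (_∈? (x ∷ xs)) ,
  core (comp⁺ (here refl)) (λ v p → let w , q , a = successor x xs (comp⁻ p) l there in w , comp⁺ q , a) , λ v p → comp⁻ p
  where
  successor : ∀ z zs {v} → v ∈ z ∷ zs → Linked (Arc G) ((z ∷ zs) ++ x ∷ []) → (∀ {w} → w ∈ zs → w ∈ x ∷ xs) →
              ∃[ w ] (w ∈ x ∷ xs × G v ∋ w)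
  successor z [] (here refl) (a ∷ _) s = x , here refl , mem a
  successor z (y ∷ ys) (here refl) (a ∷ _) s = y , s (here refl) , mem a
  successor z (y ∷ ys) (there p) (_ ∷ l) s = successor y ys p l λ q → s (there q)

intercyclic⇒¬disjoint-cycles : {G : Digraph n} → Intercyclic G → ¬ HasTwoDisjointCycles G
intercyclic⇒¬disjoint-cycles inter (c₁ , c₂ , i₁ , i₂ , dis) =
  let Y , cY , s = cycle⇒Core c₁ i₁
      Z , cZ , t = cycle⇒Core c₂ i₂
  in inter Y Z cY cZ λ v p q → dis v (s v p) (t v q)

-- From outdegree sequences to counts

full : VSet n
full _ = true

opaque
  unfolding count comp

  length-filter-tabulate : {A : Set} {P : A → Set} (P? : ∀ x → Dec (P x)) (f : Fin n → A) →
                           length (filter P? (tabulate f)) ≡ count (comp (P? ∘ f))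
  length-filter-tabulate {zero} P? f = refl
  length-filter-tabulate {suc n} P? f with does (P? (f zero))
  ... | true  = cong suc (length-filter-tabulate P? (f ∘ suc))
  ... | false = length-filter-tabulate P? (f ∘ suc)

  count-full : count (full {n}) ≡ n
  count-full {zero} = refl
  count-full {suc n} = cong suc (count-full {n})

  count-below-≤ : ∀ k → count {n} (comp λ i → toℕ i <? k) ≤ k
  count-below-≤ {zero} k = z≤n
  count-below-≤ {suc n} zero = ≤-reflexive (count-empty {P = comp λ (i : Fin (suc n)) → toℕ i <? 0} λ { v (mem ()) })
  count-below-≤ {suc n} (suc k) = s≤s (count-below-≤ {n} k)

  count-below-≥ : ∀ k → k ≤ n → k ≤ count {n} (comp λ i → toℕ i <? k)
  count-below-≥ zero h = z≤n
  count-below-≥ {suc n} (suc k) h = s≤s (count-below-≥ {n} k (s≤s⁻¹ h))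

count≤n : (P : VSet n) → count P ≤ n
count≤n P = ≤-trans (count-mono {Q = full} λ _ _ → mem refl) (≤-reflexive count-full)

outdeg≡deg : (G : Digraph n) (v : Fin n) → outdeg G v ≡ deg G v
outdeg≡deg G v = trans (length-filter-tabulate (λ y → G v y ≟ᵇ true) id)
  (≤-antisym (count-mono λ w p → mem (comp⁻ p)) (count-mono λ w p → comp⁺ (holds p)))

toList≡tabulate : (d : Vec ℕ n) → toList d ≡ tabulate (lookup d)
toList≡tabulate V.[] = refl
toList≡tabulate (x V.∷ d) = cong (x ∷_) (toList≡tabulate d)

at-suc : (d : Vec ℕ n) (v : Fin n) → at d (suc (toℕ v)) ≡ lookup d v
at-suc (x V.∷ d) zero = refl
at-suc (x V.∷ d) (suc v) = at-suc d v

at-fromℕ< : (d : Vec ℕ n) {k : ℕ} (h : k < n) → at d (suc k) ≡ lookup d (fromℕ< h)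
at-fromℕ< d h = trans (cong (at d ∘ suc) (sym (toℕ-fromℕ< h))) (at-suc d (fromℕ< h))

at-mono : (d : Vec ℕ n) → Nondecreasing d → ∀ {i j} → i ≤ j → j < n → at d (suc i) ≤ at d (suc j)
at-mono {n} d nd {i} {j} h j<n = subst (_≤ _) (sym (at-fromℕ< d i<n)) (subst (lookup d (fromℕ< i<n) ≤_) (sym (at-fromℕ< d j<n))
  (nd _ _ (≤-trans (≤-reflexive (toℕ-fromℕ< i<n)) (≤-trans h (≤-reflexive (sym (toℕ-fromℕ< j<n)))))))
  where
  i<n : i < n
  i<n = ≤-<-trans h j<n

low#≡ : (G : Digraph n) (d : Vec ℕ n) → HasOutdegSeq G d → ∀ m → low# full G m ≡ count (comp λ i → lookup d i ≤? m)
low#≡ {n} G d seq m =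
  trans (≤-antisym
      (count-mono {Q = comp λ v → outdeg G v ≤? m} λ v p → comp⁺ (subst (_≤ m) (sym (outdeg≡deg G v)) (proj₂ (low⁻ p))))
      (count-mono λ v p → low⁺ (mem refl) (subst (_≤ m) (outdeg≡deg G v) (comp⁻ p))))
  (trans (sym (length-filter-tabulate (_≤? m) (outdeg G)))
  (trans (cong (length ∘ filter (_≤? m)) (sym (map-tabulate id (outdeg G))))
  (trans (↭-length (filter-↭ (_≤? m) seq))
  (trans (cong (length ∘ filter (_≤? m)) (toList≡tabulate d)) (length-filter-tabulate (_≤? m) (lookup d))))))

-- By monotonicity, entries at most `m` occur only in the first `k` positions.
low-bound : (G : Digraph n) (d : Vec ℕ n) → HasOutdegSeq G d → Nondecreasing d →
            ∀ {k m} → k < n → m < at d (suc k) → low# full G m ≤ k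
low-bound G d seq nd {k} {m} k<n lt = ≤-trans (≤-reflexive (low#≡ G d seq m))
  (≤-trans (count-mono {Q = comp λ i → toℕ i <? k} λ v p → comp⁺ (≰⇒> λ h →
      contradiction (≤-trans lt (≤-trans (at-mono d nd h (toℕ<n v)) (≤-reflexive (at-suc d v)))) (<⇒≱ (s≤s (comp⁻ p)))))
    (count-below-≤ k))

-- The position 2s − r + 2 of condition (b).
position : ∀ ρ τ c → 2 * suc (ρ + τ) ∸ suc ρ + c ≡ suc (ρ + (τ + (τ + c)))
position ρ τ c = trans (cong (λ x → x ∸ suc ρ + c) (expand ρ τ)) (trans (cong (_+ c) (m+n∸m≡n (suc ρ) (suc (ρ + (τ + τ))))) (reassociate ρ τ c))
  where
  expand : ∀ ρ τ → 2 * suc (ρ + τ) ≡ suc ρ + suc (ρ + (τ + τ))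
  expand = solve-∀
  reassociate : ∀ ρ τ c → suc (ρ + (τ + τ)) + c ≡ suc (ρ + (τ + (τ + c)))
  reassociate = solve-∀

Large⇒forced : (d : Vec ℕ n) → Nondecreasing d → Large d → (G : Digraph n) → HasOutdegSeq G d → ¬ Intercyclic G
Large⇒forced {n} d nd (suc ρ , s , _ , r≤s , s≤n , dr , ds , b) G seq with s ∸ suc ρ | m+[n∸m]≡n r≤s
... | τ | refl = large⇒¬intercyclic ρ τ {full} {G} (λ _ _ _ → mem refl , mem refl)
    (low-bound G d seq nd (<-≤-trans (s≤s (m≤m+n ρ τ)) s≤n) dr) (low-bound G d seq nd s≤n ds)
    (≤-trans s≤n (≤-reflexive (sym count-full))) thick
  where
  K = ρ + (τ + (τ + 2))
  K≡ : K ≡ ρ + (τ + (2 + τ))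
  K≡ = cong (λ x → ρ + (τ + x)) (+-comm τ 2)
  s≤K : ρ + τ ≤ K
  s≤K = +-monoʳ-≤ ρ (m≤m+n τ _)
  tail : ∃[ j ] (2 * suc (ρ + τ) ∸ suc ρ + 3 ≤ j × j ≤ n × j ≤ at d j) →
         ∃[ i ] (ρ + (τ + (3 + τ)) ≤ i × i < count (full {n}) × low# full G i ≤ i)
  tail (zero , h , _) = contradiction (≤-trans (≤-reflexive (sym (position ρ τ 3))) h) λ ()
  tail (suc i , h , i<n , di) = i
    , s≤s⁻¹ (≤-trans (≤-reflexive (trans (cong (λ x → suc (ρ + (τ + x))) (+-comm 3 τ)) (sym (position ρ τ 3)))) h)
    , ≤-trans i<n (≤-reflexive (sym count-full)) , low-bound G d seq nd i<n di
  thick : low# full G (2 + (ρ + τ)) ≤ ρ + (τ + (2 + τ)) ⊎ ∃[ i ] (ρ + (τ + (3 + τ)) ≤ i × i < count (full {n}) × low# full G i ≤ i)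
  -- The position 2s - r + 2 is `suc K`. Its entry is at least s + 1 by monotonicity; beyond `n` or
  -- above s + 1 it bounds the low set, and equality calls on (b).
  thick with suc K ≤? n
  ... | no nK = inj₁ (≤-trans (count≤n _) (≤-trans (s≤s⁻¹ (≰⇒> nK)) (≤-reflexive K≡)))
  ... | yes K<n with m≤n⇒m<n∨m≡n (≤-trans ds (at-mono d nd s≤K K<n))
  ... | inj₁ lt = inj₁ (≤-trans (low-bound G d seq nd K<n lt) (≤-reflexive K≡))
  ... | inj₂ e = inj₂ (tail (b (subst (_≤ n) (sym (position ρ τ 2)) K<n) (trans (cong (at d) (position ρ τ 2)) (sym e))))

-- Digraphs without two disjoint cycles

_↓_ : VSet n → ℕ → VSet n
P ↓ a = comp λ w → (P ∋? w) ×-dec (toℕ w <? a)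

interval-count : (P : VSet n) (a m : ℕ) → a + m ≤ n → (∀ w → a ≤ toℕ w → toℕ w < a + m → P ∋ w) →
                 m + count (P ↓ a) ≤ count P
interval-count P a zero h all = count-mono λ w p → proj₁ (comp⁻ p)
interval-count {n} P a (suc m) h all = insert-count
  (all x (≤-trans (m≤m+n a m) (≤-reflexive (sym x≡))) (≤-trans (s≤s (≤-reflexive x≡)) (≤-reflexive (sym (+-suc a m)))))
  (≤-trans (+-monoʳ-≤ m (count-mono ↓⊆))
    (interval-count (P ∖ x) a m (<⇒≤ x<n) λ w aw wm →
      ∖⁺ (all w aw (≤-trans wm (+-monoʳ-≤ a (n≤1+n m)))) λ e → <-irrefl (trans (cong toℕ e) x≡) wm))
  where
  x<n : a + m < n
  x<n = ≤-trans (≤-reflexive (sym (+-suc a m))) h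
  x = fromℕ< x<n
  x≡ : toℕ x ≡ a + m
  x≡ = toℕ-fromℕ< x<n
  ↓⊆ : P ↓ a ⊆ (P ∖ x) ↓ a
  ↓⊆ w p = let q , lt = comp⁻ p in
    comp⁺ (∖⁺ q (λ e → <⇒≱ lt (≤-trans (m≤m+n a m) (≤-reflexive (sym (trans (cong toℕ e) x≡))))) , lt)

initial-count : {P : VSet n} {k : ℕ} → k ≤ n → (∀ w → toℕ w < k → P ∋ w) → k ≤ count P
initial-count h all = ≤-trans (count-below-≥ _ h) (count-mono λ w p → all w (comp⁻ p))

initial-count+1 : {P : VSet n} {k : ℕ} (x : Fin n) → k ≤ n → k ≤ toℕ x → (∀ w → toℕ w < k → P ∋ w) → P ∋ x → suc k ≤ count P
initial-count+1 x h kx all p = insert-count p (initial-count h λ w lt → ∖⁺ (all w lt) λ { refl → <⇒≱ lt kx })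

-- Removing arcs creates no cycles, so surplus outdegree can be trimmed away.
realize : (d : Vec ℕ n) (H : Digraph n) → (∀ v → lookup d v ≤ deg H v) → Intercyclic H →
          ∃[ G ] (HasOutdegSeq G d × ¬ HasTwoDisjointCycles G)
realize d H h inter = G , ↭-reflexive seq , intercyclic⇒¬disjoint-cycles (Intercyclic-⊆ (prune-⊆ (lookup d) H) inter)
  where
  G = prune (lookup d) H
  seq : map (outdeg G) (allFin _) ≡ toList d
  seq = trans (map-tabulate id (outdeg G)) (trans
    (tabulate-cong λ v → trans (outdeg≡deg G v) (count-take (lookup d v) (H v) (h v))) (sym (toList≡tabulate d)))

-- Arcs descend, except that the last vertex `m` is joined in both directions to every vertex,
-- itself included. Hence every cycle passes through `m`.
module Hubbed (m : ℕ) where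

  arc? : ∀ a b → Dec (b < a ⊎ b ≡ m ⊎ a ≡ m)
  arc? a b = (b <? a) ⊎-dec (b ≟ⁿ m) ⊎-dec (a ≟ⁿ m)

  H : Digraph (suc m)
  H v = comp λ w → arc? (toℕ v) (toℕ w)

  deg-H : ∀ v → suc (toℕ v) ≤ deg H v
  deg-H v with m≤n⇒m<n∨m≡n (s≤s⁻¹ (toℕ<n v))
  ... | inj₁ lt = initial-count+1 (fromℕ< (n<1+n m)) (<⇒≤ (toℕ<n v)) (≤-trans (<⇒≤ lt) (≤-reflexive (sym (toℕ-fromℕ< _))))
      (λ w h → comp⁺ (inj₁ h)) (comp⁺ (inj₂ (inj₁ (toℕ-fromℕ< _))))
  ... | inj₂ e = initial-count (toℕ<n v) λ w _ → comp⁺ (inj₂ (inj₂ e))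

  hub∈core : ∀ {Y} → Core H Y → ∃[ v ] (Y ∋ v × toℕ v ≡ m)
  hub∈core {Y} (core y next) with minimum Y toℕ y
  ... | x , x∈Y , least with next x x∈Y
  ... | w , w∈Y , a with comp⁻ a
  ... | inj₁ lt = contradiction (least w w∈Y) (<⇒≱ lt)
  ... | inj₂ (inj₁ e) = w , w∈Y , e
  ... | inj₂ (inj₂ e) = x , x∈Y , e

  intercyclic : Intercyclic H
  intercyclic Y Z cY cZ dis =
    let v , p , e = hub∈core cY
        w , q , f = hub∈core cZ
    in dis v p (subst (Z ∋_) (toℕ-injective (trans f (sym e))) q)

-- Vertices below ρ are acyclic; those in [ρ, β) also point to the hub β, whose rim is the directed cycle on (β, γ];
-- vertices above γ only point downwards.
module Wheel (n ρ β γ : ℕ) (ρ≤β : ρ ≤ β) (β<γ : β < γ) (γ<n : γ < n) where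

  -- In order: descending arcs off hub and rim, spokes into the hub, arcs leaving the hub, arcs
  -- leaving the rim. The hub has no arc to [ρ, β), so a cycle through it that avoids the vertices
  -- below `ρ` continues on the rim.
  WheelArc : ℕ → ℕ → Set
  WheelArc a b = (b < a × (a < β ⊎ γ < a))
               ⊎ (ρ ≤ a × a < β × b ≡ β)
               ⊎ (a ≡ β × (b < ρ ⊎ (β < b × b ≤ γ)))
               ⊎ (β < a × a ≤ γ × (b ≤ β ⊎ (a < γ × b ≡ suc a) ⊎ (a ≡ γ × b ≡ suc β)))

  arc? : ∀ a b → Dec (WheelArc a b)
  arc? a b = ((b <? a) ×-dec ((a <? β) ⊎-dec (γ <? a)))
       ⊎-dec ((ρ ≤? a) ×-dec (a <? β) ×-dec (b ≟ⁿ β))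
       ⊎-dec ((a ≟ⁿ β) ×-dec ((b <? ρ) ⊎-dec ((β <? b) ×-dec (b ≤? γ))))
       ⊎-dec ((β <? a) ×-dec (a ≤? γ) ×-dec ((b ≤? β) ⊎-dec ((a <? γ) ×-dec (b ≟ⁿ suc a)) ⊎-dec ((a ≟ⁿ γ) ×-dec (b ≟ⁿ suc β))))

  opaque
    H : Digraph n
    H v = comp λ w → arc? (toℕ v) (toℕ w)

    H⁺ : ∀ {v w} → WheelArc (toℕ v) (toℕ w) → H v ∋ w
    H⁺ = comp⁺

    H⁻ : ∀ {v w} → H v ∋ w → WheelArc (toℕ v) (toℕ w)
    H⁻ = comp⁻

  β<n : β < n
  β<n = <-trans β<γ γ<n

  deg-outer : ∀ v → toℕ v < β ⊎ γ < toℕ v → toℕ v ≤ deg H v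
  deg-outer v o = initial-count (<⇒≤ (toℕ<n v)) λ w lt → H⁺ (inj₁ (lt , o))

  deg-spoke : ∀ v → ρ ≤ toℕ v → toℕ v < β → suc (toℕ v) ≤ deg H v
  deg-spoke v h lt = initial-count+1 (fromℕ< β<n) (<⇒≤ (toℕ<n v)) (≤-trans (<⇒≤ lt) (≤-reflexive (sym (toℕ-fromℕ< β<n))))
    (λ w h → H⁺ (inj₁ (h , inj₁ lt))) (H⁺ (inj₂ (inj₁ (h , lt , toℕ-fromℕ< β<n))))

  deg-hub : ∀ v k → toℕ v ≡ β → β + k ≡ γ → k + ρ ≤ deg H v
  deg-hub v k e g = ≤-trans (+-monoʳ-≤ k (initial-count (≤-trans ρ≤β (<⇒≤ β<n)) λ w lt →
      comp⁺ (H⁺ (inj₂ (inj₂ (inj₁ (e , inj₁ lt)))) , ≤-trans lt (≤-trans ρ≤β (n≤1+n β)))))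
    (interval-count (H v) (suc β) k (≤-trans (s≤s (≤-reflexive g)) γ<n) λ w lo hi →
      H⁺ (inj₂ (inj₂ (inj₁ (e , inj₂ (lo , ≤-trans (s≤s⁻¹ hi) (≤-reflexive g)))))))

  deg-rim : ∀ v → β < toℕ v → toℕ v ≤ γ → 2 + β ≤ deg H v
  deg-rim v lo hi with m≤n⇒m<n∨m≡n hi
  ... | inj₁ lt = initial-count+1 (fromℕ< w<n) β<n (≤-trans (≤-trans lo (n≤1+n _)) (≤-reflexive (sym (toℕ-fromℕ< w<n))))
      (λ w h → H⁺ (inj₂ (inj₂ (inj₂ (lo , hi , inj₁ (s≤s⁻¹ h))))))
      (H⁺ (inj₂ (inj₂ (inj₂ (lo , hi , inj₂ (inj₁ (lt , toℕ-fromℕ< w<n)))))))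
    where
    w<n = ≤-<-trans lt γ<n
  ... | inj₂ e = initial-count+1 (fromℕ< w<n) β<n (≤-reflexive (sym (toℕ-fromℕ< w<n)))
      (λ w h → H⁺ (inj₂ (inj₂ (inj₂ (lo , hi , inj₁ (s≤s⁻¹ h))))))
      (H⁺ (inj₂ (inj₂ (inj₂ (lo , hi , inj₂ (inj₂ (e , toℕ-fromℕ< w<n)))))))
    where
    w<n = ≤-<-trans β<γ γ<n

  module _ {Y : VSet n} (c : Core H Y) where

    Has : ℕ → Set
    Has k = ∃[ v ] (Y ∋ v × toℕ v ≡ k)

    Has⇒∈ : ∀ v → Has (toℕ v) → Y ∋ v
    Has⇒∈ v (w , p , e) = subst (Y ∋_) (toℕ-injective e) p

    least-vertex = minimum Y toℕ (Core.base∈ c)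
    x = proj₁ least-vertex
    x∈Y = proj₁ (proj₂ least-vertex)
    least = proj₂ (proj₂ least-vertex)

    hub⇒rim : ρ ≤ toℕ x → Has β → ∃[ v ] (Y ∋ v × β < toℕ v × toℕ v ≤ γ)
    hub⇒rim h (v , p , refl) with Core.next c v p
    ... | w , q , a with H⁻ a
    ... | inj₁ (_ , inj₁ lt) = contradiction lt (<-irrefl refl)
    ... | inj₁ (_ , inj₂ lt) = contradiction (<-trans lt β<γ) (<-irrefl refl)
    ... | inj₂ (inj₁ (_ , lt , _)) = contradiction lt (<-irrefl refl)
    ... | inj₂ (inj₂ (inj₁ (_ , inj₁ lt))) = contradiction (≤-trans h (least w q)) (<⇒≱ lt)
    ... | inj₂ (inj₂ (inj₁ (_ , inj₂ (lo , hi)))) = w , q , lo , hi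
    ... | inj₂ (inj₂ (inj₂ (lt , _))) = contradiction lt (<-irrefl refl)

    least-in-wheel : (ρ ≤ toℕ x × Has β) ⊎ (β < toℕ x × toℕ x ≤ γ)
    least-in-wheel with Core.next c x x∈Y
    ... | w , q , a with H⁻ a
    ... | inj₁ (lt , _) = contradiction (least w q) (<⇒≱ lt)
    ... | inj₂ (inj₁ (h , _ , e)) = inj₁ (h , w , q , e)
    ... | inj₂ (inj₂ (inj₁ (e , _))) = inj₁ (≤-trans ρ≤β (≤-reflexive (sym e)) , x , x∈Y , e)
    ... | inj₂ (inj₂ (inj₂ (lo , hi , _))) = inj₂ (lo , hi)

    meets-rim : ∃[ v ] (Y ∋ v × β < toℕ v × toℕ v ≤ γ)
    meets-rim with least-in-wheel
    ... | inj₁ (h , b) = hub⇒rim h b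
    ... | inj₂ (lo , hi) = x , x∈Y , lo , hi

    module _ (β<x : β < toℕ x) (x≤γ : toℕ x ≤ γ) where

      rim-next : ∀ {k} → β < k → k ≤ γ → Has k → (k < γ × Has (suc k)) ⊎ (k ≡ γ × Has (suc β))
      rim-next lo hi (v , p , refl) with Core.next c v p
      ... | w , q , a with H⁻ a
      ... | inj₁ (_ , inj₁ lt) = contradiction (<-trans lt lo) (<-irrefl refl)
      ... | inj₁ (_ , inj₂ lt) = contradiction hi (<⇒≱ lt)
      ... | inj₂ (inj₁ (_ , lt , _)) = contradiction (<-trans lt lo) (<-irrefl refl)
      ... | inj₂ (inj₂ (inj₁ (e , _))) = contradiction lo (<-irrefl (sym e))
      ... | inj₂ (inj₂ (inj₂ (_ , _ , inj₁ h))) = contradiction (≤-trans (least w q) h) (<⇒≱ β<x)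
      ... | inj₂ (inj₂ (inj₂ (_ , _ , inj₂ (inj₁ (lt , e))))) = inj₁ (lt , w , q , e)
      ... | inj₂ (inj₂ (inj₂ (_ , _ , inj₂ (inj₂ (e , f))))) = inj₂ (e , w , q , f)

      upwards : ∀ j {k} → β < k → j + k ≤ γ → Has k → Has (j + k)
      upwards zero lo hi h = h
      upwards (suc j) {k} lo hi h with rim-next (≤-trans lo (m≤n+m k j)) (<⇒≤ hi) (upwards j lo (<⇒≤ hi) h)
      ... | inj₁ (_ , h′) = h′
      ... | inj₂ (e , _) = contradiction hi (<-irrefl e)

      climb : ∀ {k l} → β < k → k ≤ l → l ≤ γ → Has k → Has l
      climb {k} {l} lo kl h p = subst Has e (upwards (l ∸ k) lo (≤-trans (≤-reflexive e) h) p)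
        where
        e : l ∸ k + k ≡ l
        e = trans (+-comm (l ∸ k) k) (m+[n∸m]≡n kl)

      -- As the core lies above `β`, each rim vertex in it can only go on to its rim successor: up
      -- to `γ`, back to `suc β`, and up again.
      rim⊆ : ∀ v → β < toℕ v → toℕ v ≤ γ → Y ∋ v
      rim⊆ v lo hi with rim-next β<γ ≤-refl (climb β<x x≤γ ≤-refl (x , x∈Y , refl))
      ... | inj₁ (lt , _) = contradiction lt (<-irrefl refl)
      ... | inj₂ (_ , h) = Has⇒∈ v (climb ≤-refl lo hi h)

  -- Two cores containing the hub meet there; otherwise one of them contains the whole rim, which
  -- the other meets.
  intercyclic : Intercyclic H
  intercyclic Y Z cY cZ dis with least-in-wheel cY | least-in-wheel cZ
  ... | inj₁ (_ , v , p , e) | inj₁ (_ , w , q , f) = dis v p (subst (Z ∋_) (toℕ-injective (trans f (sym e))) q)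
  ... | inj₂ (lo , hi) | _ = let w , q , l , h = meets-rim cZ in dis w (rim⊆ cY lo hi w l h) q
  ... | inj₁ _ | inj₂ (lo , hi) = let w , q , l , h = meets-rim cY in dis w q (rim⊆ cZ lo hi w l h)

-- Sequences that are not large

least-below : {P : ℕ → Set} → (∀ k → Dec (P k)) → ∀ m → (∃[ k ] (k < m × P k × (∀ j → j < k → ¬ P j))) ⊎ (∀ k → k < m → ¬ P k)
least-below P? zero = inj₂ λ _ ()
least-below P? (suc m) with least-below P? m | P? m
... | inj₁ (k , lt , r) | _ = inj₁ (k , ≤-trans lt (n≤1+n m) , r)
... | inj₂ none | yes p = inj₁ (m , ≤-refl , p , none)
... | inj₂ none | no np = inj₂ λ k h → case m≤n⇒m<n∨m≡n (s≤s⁻¹ h) of λ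
  { (inj₁ lt) → none k lt ; (inj₂ refl) → np }

Avoidable : Vec ℕ n → Set
Avoidable {n} d = ∃[ G ] (HasOutdegSeq {n} G d × ¬ HasTwoDisjointCycles G)

hubbed-avoidable : (d : Vec ℕ n) → 1 ≤ n → (∀ k → k < n → ¬ 2 + k ≤ at d (suc k)) → Avoidable d
hubbed-avoidable {suc m} d _ small = realize d H (λ v → ≤-trans
    (≤-trans (≤-reflexive (sym (at-suc d v))) (s≤s⁻¹ (≰⇒> (small (toℕ v) (toℕ<n v))))) (deg-H v)) intercyclic
  where open Hubbed m

-- Here r = 1 + ρ and s = 1 + σ are the least indices with d_r ≥ r and d_s ≥ s + 1, and 1 + γ = 2s − r + 2.
wheel-avoidable : (d : Vec ℕ n) → Nondecreasing d → ∀ ρ τ → let σ = ρ + τ ; γ = σ + (τ + 2) in γ < n →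
  (∀ k → k < ρ → ¬ 1 + k ≤ at d (suc k)) → (∀ k → k < σ → ¬ 2 + k ≤ at d (suc k)) →
  at d (suc γ) ≡ 2 + σ → (∀ k → γ < k → k < n → ¬ 1 + k ≤ at d (suc k)) → Avoidable d
wheel-avoidable {n} d nd ρ τ γ<n below mid top above = realize d H enough intercyclic
  where
  σ = ρ + τ
  γ = σ + (τ + 2)
  σ<γ : σ < γ
  σ<γ = ≤-trans (≤-reflexive (+-comm 1 σ)) (+-monoʳ-≤ σ (≤-trans (n≤1+n 1) (m≤n+m 2 τ)))
  open Wheel n ρ σ γ (m≤m+n ρ τ) σ<γ γ<n
  wheel-degree : ∀ v → toℕ v ≤ γ → lookup d v ≤ 2 + σ
  wheel-degree v h = ≤-trans (≤-reflexive (sym (at-suc d v))) (≤-trans (at-mono d nd h γ<n) (≤-reflexive top))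
  enough : ∀ v → lookup d v ≤ deg H v
  enough v with toℕ v <? ρ
  ... | yes lt = ≤-trans (≤-trans (≤-reflexive (sym (at-suc d v))) (s≤s⁻¹ (≰⇒> (below (toℕ v) lt))))
                   (deg-outer v (inj₁ (≤-trans lt (m≤m+n ρ τ))))
  ... | no nlt with <-cmp (toℕ v) σ
  ... | tri< lt _ _ = ≤-trans (≤-trans (≤-reflexive (sym (at-suc d v))) (s≤s⁻¹ (≰⇒> (mid (toℕ v) lt))))
                        (deg-spoke v (≮⇒≥ nlt) lt)
  -- The rim has `τ + 2` vertices; with the `ρ` lowest ones they give the hub exactly the outdegree
  -- `2 + σ`.
  ... | tri≈ _ e _ = ≤-trans (wheel-degree v (≤-trans (≤-reflexive e) (<⇒≤ σ<γ)))
                       (≤-trans (≤-reflexive (rearrange ρ τ)) (deg-hub v (τ + 2) e refl))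
    where
    rearrange : ∀ ρ τ → 2 + (ρ + τ) ≡ τ + 2 + ρ
    rearrange = solve-∀
  ... | tri> _ _ gt with toℕ v ≤? γ
  ... | yes h = ≤-trans (wheel-degree v h) (deg-rim v gt h)
  ... | no nh = ≤-trans (≤-trans (≤-reflexive (sym (at-suc d v))) (s≤s⁻¹ (≰⇒> (above (toℕ v) (≰⇒> nh) (toℕ<n v)))))
                  (deg-outer v (inj₂ (≰⇒> nh)))

-- If no s has d_s ≥ s + 1, the hubbed digraph suffices. Otherwise the least such s and the least r
-- with d_r ≥ r can fail only (b), and then their minimality bounds the sequence by the outdegrees
-- of the wheel.
Large⊎Avoidable : (d : Vec ℕ n) → 1 ≤ n → Nondecreasing d → Large d ⊎ Avoidable d
Large⊎Avoidable {n} d 1≤n nd with least-below (λ k → 2 + k ≤? at d (suc k)) n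
... | inj₂ small = inj₂ (hubbed-avoidable d 1≤n small)
... | inj₁ (σ , σ<n , dσ , mid) with least-below (λ k → 1 + k ≤? at d (suc k)) (suc σ)
... | inj₂ none = contradiction (≤-trans (n≤1+n _) dσ) (none σ ≤-refl)
... | inj₁ (ρ , ρ<sσ , dρ , below) with σ ∸ ρ | m+[n∸m]≡n (s≤s⁻¹ ρ<sσ)
... | τ | refl with least-below (λ j → (2 * suc (ρ + τ) ∸ suc (ρ + τ) + 3 ≤? j) ×-dec (j ≤? at d j)) (suc n)
-- Choosing r = s lowers the threshold 2s - r + 3 to s + 3, so any such `j` settles (b). In the
-- other cases no `j` beyond the rim remains.
... | inj₁ (j , j≤n , (h , dj) , _) =
  inj₁ (suc σ , suc σ , s≤s z≤n , ≤-refl , σ<n , ≤-trans (n≤1+n _) dσ , dσ , λ _ _ → j , h , s≤s⁻¹ j≤n , dj)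
... | inj₂ no-j with (2 * suc (ρ + τ) ∸ suc ρ + 2 ≤? n) ×-dec (at d (2 * suc (ρ + τ) ∸ suc ρ + 2) ≟ⁿ 2 + (ρ + τ))
... | no nb = inj₁ (suc ρ , suc σ , s≤s z≤n , ρ<sσ , σ<n , dρ , dσ , λ a b → contradiction (a , b) nb)
... | yes (K≤n , top) = inj₂ (wheel-avoidable d nd ρ τ (subst (_≤ n) K≡ K≤n) below mid (trans (cong (at d) (sym K≡)) top) above)
  where
  K≡ : 2 * suc (ρ + τ) ∸ suc ρ + 2 ≡ suc (ρ + τ + (τ + 2))
  K≡ = trans (position ρ τ 2) (cong suc (sym (+-assoc ρ τ (τ + 2))))
  s+3 : 2 * suc (ρ + τ) ∸ suc (ρ + τ) + 3 ≡ suc (suc (ρ + τ + 2))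
  s+3 = trans (cong (_+ 3) (m+n∸m≡n (suc (ρ + τ)) (suc (ρ + τ) + 0))) 
    (trans (cong (_+ 3) (+-identityʳ (suc (ρ + τ)))) (cong suc (+-suc (ρ + τ) 2)))
  above : ∀ k → ρ + τ + (τ + 2) < k → k < n → ¬ 1 + k ≤ at d (suc k)
  above k γ<k k<n dk = no-j (suc k) (s≤s k<n)
    (≤-trans (≤-reflexive s+3) (s≤s (≤-trans (s≤s (+-monoʳ-≤ (ρ + τ) (m≤n+m 2 τ))) γ<k)) , dk)

theorem1p4 : (n : ℕ) (d : Vec ℕ n) → 1 ≤ n → Nondecreasing d →
    ((∀ (G : Digraph n) → HasOutdegSeq G d → HasTwoDisjointCycles G) ⇔ Large d)
theorem1p4 n d 1≤n nd = mk⇔ to λ large G seq → disjoint-cycles (Large⇒forced d nd large G seq)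
  where
  to : (∀ G → HasOutdegSeq G d → HasTwoDisjointCycles G) → Large d
  to forced with Large⊎Avoidable d 1≤n nd
  ... | inj₁ large = large
  ... | inj₂ (G , seq , none) = contradiction (forced G seq) none
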